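{- There is an absolute constant $C$ such that the following holds. If $G$ is an abelian group and $A\subseteq G$ has size $n\ge 3$ with $|A-A|\le K|A|$, then $d_*(A)\le C(K\log\log n+\log n)$. Furthermore, if $G$ has exponent $r\ge 2$, then $d_*(A)\le C(K\log r+\log n)$.
   Context: For a sequence $S=(c_1,\dots,c_t)$ of elements of an abelian group $G$, $\mathrm{span}(S)$ is the set of all sums $\sum_{i=1}^t w_ic_i$ with $w_i\in\{ -1,0,1\}$. The additive dimension $d_*(A)$ of $A\subseteq G$ is the minimum length of a sequence $S$ with $A\subseteq\mathrm{span}(S)$. $A-A=\{a-b:a,b\in A\}$. -}

module Defs where

open import Level using (Level; _⊔_; Setω)
open import Algebra.Bundles using (AbelianGroup)
open import Data.Nat using (ℕ; zero; suc; _≤_; _*_; _+_)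
open import Data.Nat.Logarithm using (⌈log₂_⌉)
open import Data.List using (List; []; _∷_; length)
open import Data.Vec using (Vec; []; _∷_)
open import Data.Product using (Σ; _×_; ∃)
import Data.List.Relation.Unary.Unique.Setoid as UniqueS
import Data.List.Membership.Setoid as MemS

data Sign : Set where
  neg zer pos : Sign

-- Existential over ℕ landing in Setω (the statement quantifies over all universe levels)
record Σℕω (P : ℕ → Setω) : Setω where
  constructor _,_
  field
    witness : ℕ
    proof   : P witness

module _ {c ℓ : Level} (G : AbelianGroup c ℓ) where
  open AbelianGroup G renaming (Carrier to X)
  open UniqueS setoid using (Unique)
  open MemS setoid using (_∈_)

  signed : Sign → X → X
  signed neg x = x ⁻¹
  signed zer x = ε
  signed pos x = x

  lincomb : (S : List X) → Vec Sign (length S) → X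
  lincomb []       []       = ε
  lincomb (c ∷ cs) (w ∷ ws) = signed w c ∙ lincomb cs ws

  InSpan : List X → X → Set ℓ
  InSpan S x = Σ (Vec Sign (length S)) λ w → x ≈ lincomb S w

  FinSubset : List X → Set (c ⊔ ℓ)
  FinSubset A = Unique A

  -- d_*(A) ≤ m  (d_* is a minimum, so this unfolds to existence of a spanning sequence of length ≤ m)
  AddDimAtMost : List X → ℕ → Set (c ⊔ ℓ)
  AddDimAtMost A m = Σ (List X) λ S → length S ≤ m × (∀ {a} → a ∈ A → InSpan S a)

  -- D is (a duplicate-free enumeration of) the set A - A, so |A - A| = length D
  IsDiffSet : List X → List X → Set (c ⊔ ℓ)
  IsDiffSet A D =
    Unique D ×
    (∀ {x} → x ∈ D → ∃ λ a → ∃ λ b → a ∈ A × b ∈ A × x ≈ a - b) ×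
    (∀ {a b} → a ∈ A → b ∈ A → (a - b) ∈ D)

  mult : ℕ → X → X
  mult zero    x = ε
  mult (suc n) x = x ∙ mult n x

  HasExponent : ℕ → Set (c ⊔ ℓ)
  HasExponent r =
    1 ≤ r × (∀ x → mult r x ≈ ε) × (∀ s → 1 ≤ s → (∀ x → mult s x ≈ ε) → r ≤ s)

{-# OPTIONS --safe #-}

-- Let n = |A| and |A - A| ≤ k n.  Colour the pair (x , y) by y - x, splitting popular differences so
-- that each of the N = O(k n) colours belongs to O(n / k) pairs; the n pairs (x , ·) have distinct
-- colours.  Keep every colour with probability of order 1 / n, hence O(k) of them.  Explore from x along
-- kept colours, visiting only vertices which contribute at least 3n/4 new colours.  This is a
-- supercritical branching process, so for most x it goes on until the O(N / n) visited vertices own a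
-- positive proportion of all colours; then one more random colour leads with positive probability from
-- the cluster of x to another, almost uniformly distributed vertex.  So boundedly many extra colours
-- enlarge the set of vertices reachable from x by the factor 3/2 for most x, unless some u is already
-- reachable from n / 16 of them, and such a u appears after O(log n) extra colours.  Therefore a set
-- Z ⊆ A of size n / 16 lies in u minus combinations of the extra colours with coefficients 0, 1 and of
-- the kept ones with coefficients O(log n).  By Ruzsa's covering argument A ⊆ Y + Z - Z with
-- |Y| = O(k), and the coefficients of the O(k) kept colours are finally written in binary.
module Submission where

open import Defs
open import Level using (Level; _⊔_)
open import Algebra.Bundles using (AbelianGroup)
open import Data.Nat hiding (_⊔_)
open import Data.Nat.Logarithm
open import Data.List as List using (List; []; _∷_; length; _++_; map; allFin)
open import Data.Product using (Σ; ∃; _×_; _,_; proj₁; proj₂)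

import Algebra.Properties.AbelianGroup as AGProps
import Algebra.Properties.CommutativeMonoid.Sum as CMSum
import Algebra.Properties.CommutativeSemigroup as CSProps
open import Data.Bool using (Bool; true; false; not; _∧_; _∨_; if_then_else_; T)
open import Data.Empty using (⊥-elim)
open import Data.Fin using (Fin; zero; suc)
open import Data.Fin.Properties using (injective⇒≤)
open import Data.List.Membership.Propositional using () renaming (_∈_ to _∈ₗ_)
open import Data.List.Membership.Propositional.Properties using (∈-allFin; ∈-map⁺; ∈-++⁺ˡ; ∈-++⁺ʳ; ∈-lookup)
import Data.List.Membership.Setoid.Properties as MemP
open import Data.List.Properties using (length-++; length-map)
open import Data.List.Relation.Unary.All as All using (All; []; _∷_)
import Data.List.Relation.Unary.All.Properties as Allₚ
open import Data.List.Relation.Unary.AllPairs using (_∷_)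
open import Data.List.Relation.Unary.Any using (Any; here; there; index)
open import Data.List.Relation.Unary.Any.Properties using (lookup-index)
open import Data.Maybe using (Maybe; just; nothing; maybe′)
open import Data.Nat.DivMod using (_/_; _%_; m≡m%n+[m/n]*n; m%n<n; m/n*n≤m)
open import Data.Nat.Induction using (<-wellFounded)
open import Data.Nat.Properties
open import Algebra.Properties.Semiring.Sum +-*-semiring using (sum; sum-cong-≗; ∑-distrib-+; ∑-comm; *-distribˡ-sum; *-distribʳ-sum; sum-replicate-zero)
open import Data.Nat.Tactic.RingSolver using (solve-∀)
open import Data.Sum using (_⊎_; inj₁; inj₂)
open import Data.Unit.Polymorphic using (⊤; tt)
open import Data.Vec using (Vec; []; _∷_; lookup; _[_]≔_)
open import Data.Vec.Properties using (lookup∘update′)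
open import Function using (_∘_)
open import Induction.WellFounded using (Acc; acc)
open import Relation.Binary.PropositionalEquality hiding (setoid)
open import Relation.Nullary using (¬_; Dec; yes; no)

-- The kept colours are drawn once and reused in every epoch. This separates the two terms of the
-- bound: O(log n) epochs with boundedly many extra colours each account for log n, while each of
-- the O(k) kept colours acquires a multiplicity O(log n), whose binary digits cost log log n, or
-- log r in exponent r.
--
-- A random colour has to lead to a nearly uniform vertex although the shape of a cluster is
-- arbitrary. This is the reason for the threshold 3n/4: j visited vertices own at least 3nj/4
-- colours, but no vertex is the target of more than j of them, so a set of 3n/8 exceptional
-- vertices absorbs at most half. The exceptional vertices are the n/4 that are not good and the n/8
-- whose reachable set overlaps too much with one already found. If there were more of the latter,
-- double counting would give a u reachable from more than n/16 vertices.
--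
-- Probability is replaced by sums with natural-number weights; random objects are found by
-- averaging.

module Counting where

  private variable
    n N : ℕ

  sum-mono : {f g : Fin n → ℕ} → (∀ i → f i ≤ g i) → sum f ≤ sum g
  sum-mono {zero}  f≤g = z≤n
  sum-mono {suc n} f≤g = +-mono-≤ (f≤g zero) (sum-mono (f≤g ∘ suc))

  sum-const : ∀ n c → sum {n} (λ _ → c) ≡ n * c
  sum-const zero    c = refl
  sum-const (suc n) c = cong (c +_) (sum-const n c)

  sum-≗0 : {f : Fin n → ℕ} → (∀ i → f i ≡ 0) → sum f ≡ 0
  sum-≗0 {n} h = trans (sum-cong-≗ h) (sum-replicate-zero n)

  term≤sum : (f : Fin n → ℕ) (i : Fin n) → f i ≤ sum f
  term≤sum f zero    = m≤m+n (f zero) _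
  term≤sum f (suc i) = ≤-trans (term≤sum (f ∘ suc) i) (m≤n+m _ (f zero))

  average : (f : Fin (suc n) → ℕ) (c : ℕ) → sum f ≤ suc n * c → ∃ λ i → f i ≤ c
  average {zero}  f c h = zero , subst₂ _≤_ (+-identityʳ _) (+-identityʳ c) h
  average {suc n} f c h with f zero ≤? c
  ... | yes f₀≤c = zero , f₀≤c
  ... | no  f₀≰c = let i , fi≤c = average (f ∘ suc) c rest in suc i , fi≤c
    where
    rest : sum (f ∘ suc) ≤ suc n * c
    rest = +-cancelˡ-≤ c _ _ (≤-trans (+-monoˡ-≤ _ (<⇒≤ (≰⇒> f₀≰c))) h)

  χ : Bool → ℕ
  χ true  = 1
  χ false = 0

  χ≤1 : ∀ b → χ b ≤ 1
  χ≤1 true  = ≤-refl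
  χ≤1 false = z≤n

  χ-mono : ∀ {a b} → (a ≡ true → b ≡ true) → χ a ≤ χ b
  χ-mono {false}     h = z≤n
  χ-mono {true}  {b} h rewrite h refl = ≤-refl

  χ-∨ : ∀ a b → χ (a ∨ b) ≤ χ a + χ b
  χ-∨ true  b = s≤s z≤n
  χ-∨ false b = ≤-refl

  count : (Fin n → Bool) → ℕ
  count P = sum (χ ∘ P)

  count-mono : {P Q : Fin n → Bool} → (∀ i → P i ≡ true → Q i ≡ true) → count P ≤ count Q
  count-mono h = sum-mono (λ i → χ-mono (h i))

  count≤ : (P : Fin n → Bool) → count P ≤ n
  count≤ {n} P = ≤-trans (sum-mono (χ≤1 ∘ P)) (≤-reflexive (trans (sum-const n 1) (*-identityʳ n)))

  count-not : (P : Fin n → Bool) → count P + count (not ∘ P) ≡ n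
  count-not {zero}  P = refl
  count-not {suc n} P with P zero
  ... | true  = cong suc (count-not (P ∘ suc))
  ... | false = trans (+-suc _ _) (cong suc (count-not (P ∘ suc)))

  count-∨ : (P Q : Fin n → Bool) → count (λ i → P i ∨ Q i) ≤ count P + count Q
  count-∨ P Q = ≤-trans (sum-mono (λ i → χ-∨ (P i) (Q i))) (≤-reflexive (∑-distrib-+ (χ ∘ P) (χ ∘ Q)))

  count≤+ : (P Q R : Fin n → Bool) → (∀ i → P i ≡ true → Q i ≡ true ⊎ R i ≡ true) →
            count P ≤ count Q + count R
  count≤+ P Q R h = ≤-trans (count-mono (λ i p → or (h i p))) (count-∨ Q R)
    where
    or : ∀ {a b} → a ≡ true ⊎ b ≡ true → (a ∨ b) ≡ true
    or         (inj₁ refl) = refl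
    or {true}  (inj₂ _)    = refl
    or {false} (inj₂ refl) = refl

  count-full : (P : Fin n → Bool) → (∀ i → P i ≡ true) → count P ≡ n
  count-full {n} P h = ≤-antisym (count≤ P)
    (≤-trans (≤-reflexive (trans (sym (*-identityʳ n)) (sym (sum-const n 1))))
             (sum-mono (λ i → ≤-reflexive (cong χ (sym (h i))))))

  find : (P : Fin n → Bool) → (∃ λ i → P i ≡ true) ⊎ (∀ i → P i ≡ false)
  find {zero}  P = inj₂ λ ()
  find {suc n} P with P zero in eq | find (P ∘ suc)
  ... | true  | _            = inj₁ (zero , eq)
  ... | false | inj₁ (i , p) = inj₁ (suc i , p)
  ... | false | inj₂ none    = inj₂ λ { zero → eq ; (suc i) → none i }

  count-witness : (P : Fin n → Bool) → 0 < count P → ∃ λ i → P i ≡ true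
  count-witness {n} P 0<c with find P
  ... | inj₁ w    = w
  ... | inj₂ none = ⊥-elim (<-irrefl (sym (sum-≗0 (λ i → cong χ (none i)))) 0<c)

  _==_ : Fin n → Fin n → Bool
  zero  == zero  = true
  zero  == suc j = false
  suc i == zero  = false
  suc i == suc j = i == j

  ==-refl : (i : Fin n) → (i == i) ≡ true
  ==-refl zero    = refl
  ==-refl (suc i) = ==-refl i

  ==⇒≡ : (i j : Fin n) → (i == j) ≡ true → i ≡ j
  ==⇒≡ zero    zero    _ = refl
  ==⇒≡ (suc i) (suc j) p = cong suc (==⇒≡ i j p)

  -- Evaluation at j, written as a sum so that it can be interchanged with other sums.
  sum-δ : (g : Fin n → ℕ) (j : Fin n) → sum (λ i → g i * χ (i == j)) ≡ g j
  sum-δ {suc n} g zero    = trans (cong₂ _+_ (*-identityʳ (g zero)) (sum-≗0 (λ i → *-zeroʳ (g (suc i))))) (+-identityʳ _)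
  sum-δ {suc n} g (suc j) = trans (cong (_+ sum (λ i → g (suc i) * χ (i == j))) (*-zeroʳ (g zero))) (sum-δ (g ∘ suc) j)

  sum-χ-== : (j : Fin n) → sum (λ i → χ (i == j)) ≡ 1
  sum-χ-== j = trans (sum-cong-≗ (λ i → sym (+-identityʳ (χ (i == j))))) (sum-δ (λ _ → 1) j)

  count-unique : (P : Fin n → Bool) → (∀ i j → P i ≡ true → P j ≡ true → i ≡ j) → count P ≤ 1
  count-unique P h with find P
  ... | inj₁ (i , p) = ≤-trans (count-mono (λ i′ p′ → subst (λ z → (z == i) ≡ true) (sym (h i′ i p′ p)) (==-refl i))) (≤-reflexive (sum-χ-== i))
  ... | inj₂ none    = ≤-trans (≤-reflexive (sum-≗0 (λ i → cong χ (none i)))) z≤n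

  hits : (Fin n → Bool) → Maybe (Fin n) → Bool
  hits Q = maybe′ Q false

  defined : Maybe (Fin n) → Bool
  defined = maybe′ (λ _ → true) false

  count-fibres : (τ : Fin N → Maybe (Fin n)) (Q : Fin n → Bool) (j : ℕ) →
                 (∀ b → count (λ v → hits (b ==_) (τ v)) ≤ j) →
                 count (λ v → hits Q (τ v)) ≤ j * count Q
  count-fibres τ Q j fib = begin
    count (λ v → hits Q (τ v))                                   ≡⟨ sum-cong-≗ (λ v → expand (τ v)) ⟩
    sum (λ v → sum (λ b → χ (Q b) * χ (hits (b ==_) (τ v))))     ≡⟨ ∑-comm (λ v b → χ (Q b) * χ (hits (b ==_) (τ v))) ⟩
    sum (λ b → sum (λ v → χ (Q b) * χ (hits (b ==_) (τ v))))     ≡⟨ sum-cong-≗ (λ b → sym (*-distribˡ-sum (χ (Q b)) (λ v → χ (hits (b ==_) (τ v))))) ⟩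
    sum (λ b → χ (Q b) * count (λ v → hits (b ==_) (τ v)))       ≤⟨ sum-mono (λ b → *-monoʳ-≤ (χ (Q b)) (fib b)) ⟩
    sum (λ b → χ (Q b) * j)                                      ≡⟨ sum-cong-≗ (λ b → *-comm (χ (Q b)) j) ⟩
    sum (λ b → j * χ (Q b))                                      ≡⟨ *-distribˡ-sum j (χ ∘ Q) ⟨
    j * count Q                                                  ∎
    where
    open ≤-Reasoning
    expand : ∀ m → χ (hits Q m) ≡ sum (λ b → χ (Q b) * χ (hits (b ==_) m))
    expand (just b) = sym (sum-δ (χ ∘ Q) b)
    expand nothing  = sym (sum-≗0 (λ b → *-zeroʳ (χ (Q b))))

  -- Random bit vectors, where each bit is true with probability 1 / (1 + l).  𝔼 is not normalised.

  module Expectation (l : ℕ) where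

    𝔼 : (Vec Bool N → ℕ) → ℕ
    𝔼 {zero}  g = g []
    𝔼 {suc N} g = 𝔼 (g ∘ (true ∷_)) + l * 𝔼 (g ∘ (false ∷_))

    𝔼-cong : {g h : Vec Bool N → ℕ} → (∀ f → g f ≡ h f) → 𝔼 g ≡ 𝔼 h
    𝔼-cong {zero}  e = e []
    𝔼-cong {suc N} e = cong₂ _+_ (𝔼-cong (e ∘ (true ∷_))) (cong (l *_) (𝔼-cong (e ∘ (false ∷_))))

    𝔼-const : ∀ N c → 𝔼 {N} (λ _ → c) ≡ c * suc l ^ N
    𝔼-const zero    c = sym (*-identityʳ c)
    𝔼-const (suc N) c rewrite 𝔼-const N c = lem c l (suc l ^ N)
      where
      lem : ∀ c l e → c * e + l * (c * e) ≡ c * ((1 + l) * e)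
      lem = solve-∀

    𝔼-+ : (g h : Vec Bool N → ℕ) → 𝔼 (λ f → g f + h f) ≡ 𝔼 g + 𝔼 h
    𝔼-+ {zero}  g h = refl
    𝔼-+ {suc N} g h rewrite 𝔼-+ (g ∘ (true ∷_)) (h ∘ (true ∷_)) | 𝔼-+ (g ∘ (false ∷_)) (h ∘ (false ∷_)) =
      lem (𝔼 (g ∘ (true ∷_))) (𝔼 (h ∘ (true ∷_))) (𝔼 (g ∘ (false ∷_))) (𝔼 (h ∘ (false ∷_))) l
      where
      lem : ∀ a b c d l → (a + b) + l * (c + d) ≡ (a + l * c) + (b + l * d)
      lem = solve-∀

    𝔼-* : ∀ c (g : Vec Bool N → ℕ) → 𝔼 (λ f → c * g f) ≡ c * 𝔼 g
    𝔼-* {zero}  c g = refl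
    𝔼-* {suc N} c g rewrite 𝔼-* c (g ∘ (true ∷_)) | 𝔼-* c (g ∘ (false ∷_)) = lem c l (𝔼 (g ∘ (true ∷_))) (𝔼 (g ∘ (false ∷_)))
      where
      lem : ∀ c l a b → c * a + l * (c * b) ≡ c * (a + l * b)
      lem = solve-∀

    𝔼-sum : (g : Fin n → Vec Bool N → ℕ) → 𝔼 (λ f → sum (λ i → g i f)) ≡ sum (λ i → 𝔼 (g i))
    𝔼-sum {zero}  {N} g = 𝔼-const N 0
    𝔼-sum {suc n} {N} g = trans (𝔼-+ (g zero) (λ f → sum (λ i → g (suc i) f))) (cong (𝔼 (g zero) +_) (𝔼-sum (g ∘ suc)))

    -- Method of conditional expectations: the bits are fixed one at a time, always on a side whose
    -- mean does not exceed `c`.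
    𝔼-witness : (g : Vec Bool N → ℕ) (c : ℕ) → 𝔼 g ≤ c * suc l ^ N → ∃ λ f → g f ≤ c
    𝔼-witness {zero}  g c h = [] , ≤-trans h (≤-reflexive (*-identityʳ c))
    𝔼-witness {suc N} g c h with 𝔼 (g ∘ (true ∷_)) ≤? c * suc l ^ N | 𝔼 (g ∘ (false ∷_)) ≤? c * suc l ^ N
    ... | yes t | _ with 𝔼-witness (g ∘ (true ∷_)) c t
    ...   | f , p = true ∷ f , p
    𝔼-witness {suc N} g c h | no _ | yes u with 𝔼-witness (g ∘ (false ∷_)) c u
    ...   | f , p = false ∷ f , p
    𝔼-witness {suc N} g c h | no ¬t | no ¬u = ⊥-elim (<-irrefl refl (begin-strict
      c * (suc l * E)        ≡⟨ lem c l E ⟩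
      c * E + l * (c * E)    <⟨ +-mono-<-≤ (≰⇒> ¬t) (*-monoʳ-≤ l (<⇒≤ (≰⇒> ¬u))) ⟩
      𝔼 g                    ≤⟨ h ⟩
      c * (suc l * E)        ∎))
      where
      open ≤-Reasoning
      E = suc l ^ N
      lem : ∀ c l e → c * ((1 + l) * e) ≡ c * e + l * (c * e)
      lem = solve-∀

    -- A bit is independent of whatever does not look at it.
    𝔼-query : (v : Fin N) (g₁ g₀ : Vec Bool N → ℕ) →
              (∀ f b → g₁ (f [ v ]≔ b) ≡ g₁ f) → (∀ f b → g₀ (f [ v ]≔ b) ≡ g₀ f) →
              suc l * 𝔼 (λ f → if lookup f v then g₁ f else g₀ f) ≡ 𝔼 g₁ + l * 𝔼 g₀
    𝔼-query {suc N} zero g₁ g₀ i₁ i₀ = begin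
      suc l * (𝔼 (g₁ ∘ (true ∷_)) + l * 𝔼 (g₀ ∘ (false ∷_)))
        ≡⟨ lem l (𝔼 (g₁ ∘ (true ∷_))) (𝔼 (g₀ ∘ (false ∷_))) ⟩
      (𝔼 (g₁ ∘ (true ∷_)) + l * 𝔼 (g₁ ∘ (true ∷_))) + l * (𝔼 (g₀ ∘ (false ∷_)) + l * 𝔼 (g₀ ∘ (false ∷_)))
        ≡⟨ cong₂ (λ a b → (𝔼 (g₁ ∘ (true ∷_)) + l * a) + l * (b + l * 𝔼 (g₀ ∘ (false ∷_))))
             (𝔼-cong (λ f → i₁ (false ∷ f) true)) (𝔼-cong (λ f → i₀ (true ∷ f) false)) ⟩
      𝔼 g₁ + l * 𝔼 g₀ ∎
      where
      open ≡-Reasoning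
      lem : ∀ l a b → (1 + l) * (a + l * b) ≡ (a + l * a) + l * (b + l * b)
      lem = solve-∀
    𝔼-query {suc N} (suc v) g₁ g₀ i₁ i₀ = begin
      suc l * (X + l * Y)             ≡⟨ lem l X Y ⟩
      suc l * X + l * (suc l * Y)
        ≡⟨ cong₂ (λ a b → a + l * b)
             (𝔼-query v (g₁ ∘ (true ∷_)) (g₀ ∘ (true ∷_)) (λ f → i₁ (true ∷ f)) (λ f → i₀ (true ∷ f)))
             (𝔼-query v (g₁ ∘ (false ∷_)) (g₀ ∘ (false ∷_)) (λ f → i₁ (false ∷ f)) (λ f → i₀ (false ∷ f))) ⟩
      (a + l * b) + l * (c + l * d)   ≡⟨ lem′ l a b c d ⟩
      (a + l * c) + l * (b + l * d)   ∎
      where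
      open ≡-Reasoning
      X = 𝔼 (λ f → if lookup f v then g₁ (true ∷ f) else g₀ (true ∷ f))
      Y = 𝔼 (λ f → if lookup f v then g₁ (false ∷ f) else g₀ (false ∷ f))
      a = 𝔼 (g₁ ∘ (true ∷_))
      b = 𝔼 (g₀ ∘ (true ∷_))
      c = 𝔼 (g₁ ∘ (false ∷_))
      d = 𝔼 (g₀ ∘ (false ∷_))
      lem : ∀ l x y → (1 + l) * (x + l * y) ≡ (1 + l) * x + l * ((1 + l) * y)
      lem = solve-∀
      lem′ : ∀ l a b c d → (a + l * b) + l * (c + l * d) ≡ (a + l * c) + l * (b + l * d)
      lem′ = solve-∀

    𝔼-bit : (v : Fin N) → suc l * 𝔼 (λ f → χ (lookup f v)) ≡ suc l ^ N
    𝔼-bit {N} v = begin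
      suc l * 𝔼 (λ f → χ (lookup f v))                   ≡⟨ cong (suc l *_) (𝔼-cong {N} (λ f → χ-if (lookup f v))) ⟩
      suc l * 𝔼 {N} (λ f → if lookup f v then 1 else 0)  ≡⟨ 𝔼-query v (λ _ → 1) (λ _ → 0) (λ _ _ → refl) (λ _ _ → refl) ⟩
      𝔼 {N} (λ _ → 1) + l * 𝔼 {N} (λ _ → 0)              ≡⟨ cong₂ (λ a b → a + l * b) (𝔼-const N 1) (𝔼-const N 0) ⟩
      1 * suc l ^ N + l * 0                              ≡⟨ lem l (suc l ^ N) ⟩
      suc l ^ N                                          ∎
      where
      open ≡-Reasoning
      χ-if : ∀ b → χ b ≡ (if b then 1 else 0)
      χ-if true  = refl
      χ-if false = refl
      lem : ∀ l e → 1 * e + l * 0 ≡ e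
      lem = solve-∀

open Counting

≤ᵇ-true : ∀ m n → (m ≤ᵇ n) ≡ true → m ≤ n
≤ᵇ-true m n p = ≤ᵇ⇒≤ m n (subst T (sym p) _)

≤ᵇ-false : ∀ m n → (m ≤ᵇ n) ≡ false → n < m
≤ᵇ-false m n p = ≰⇒> (λ m≤n → subst T p (≤⇒≤ᵇ m≤n))

∨-introˡ : ∀ {a b} → a ≡ true → (a ∨ b) ≡ true
∨-introˡ refl = refl

∨-introʳ : ∀ {a b} → b ≡ true → (a ∨ b) ≡ true
∨-introʳ {true}  _    = refl
∨-introʳ {false} refl = refl

∨-elim : ∀ {a b} → (a ∨ b) ≡ true → a ≡ true ⊎ b ≡ true
∨-elim {true}  _ = inj₁ refl
∨-elim {false} p = inj₂ p

∧-elim : ∀ {a b} → (a ∧ b) ≡ true → a ≡ true × b ≡ true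
∧-elim {true} p = refl , p

not-true : ∀ {a} → not a ≡ true → a ≡ false
not-true {false} _ = refl

true≢false : ∀ {a} {A : Set} → a ≡ true → a ≡ false → A
true≢false refl ()

count-insert : ∀ {n} (P : Fin n → Bool) (v : Fin n) → P v ≡ false →
               count (λ u → P u ∨ (u == v)) ≡ suc (count P)
count-insert P v Pv = trans (sum-cong-≗ pointwise) (trans (∑-distrib-+ (χ ∘ P) (λ u → χ (u == v)))
                        (trans (cong (count P +_) (sum-χ-== v)) (+-comm (count P) 1)))
  where
  disjoint : ∀ a b → (a ≡ true → b ≡ true → 1 ≡ 0) → χ (a ∨ b) ≡ χ a + χ b
  disjoint true  true  h = ⊥-elim (1+n≢0 (h refl refl))
  disjoint true  false h = refl
  disjoint false b     h = refl
  pointwise : ∀ u → χ (P u ∨ (u == v)) ≡ χ (P u) + χ (u == v)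
  pointwise u = disjoint (P u) (u == v) (λ Pu u=v → true≢false (subst (λ z → P z ≡ true) (==⇒≡ u v u=v) Pu) Pv)

^-distribʳ-* : ∀ j a b → (a * b) ^ j ≡ a ^ j * b ^ j
^-distribʳ-* zero    a b = refl
^-distribʳ-* (suc j) a b rewrite ^-distribʳ-* j a b = lem a b (a ^ j) (b ^ j)
  where
  lem : ∀ a b c d → a * b * (c * d) ≡ a * c * (b * d)
  lem = solve-∀

bernoulli : ∀ x y h → x ^ suc h + suc h * (y * x ^ h) ≤ (x + y) ^ suc h
bernoulli x y zero    = ≤-reflexive (lem x y)
  where
  lem : ∀ x y → x * 1 + 1 * (y * 1) ≡ (x + y) * 1
  lem = solve-∀
bernoulli x y (suc h) = begin
  x * (x * X) + suc (suc h) * (y * (x * X))                            ≤⟨ m≤m+n _ (suc h * (y * (y * X))) ⟩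
  x * (x * X) + suc (suc h) * (y * (x * X)) + suc h * (y * (y * X))    ≡⟨ lem x y X h ⟩
  (x + y) * (x * X + suc h * (y * X))                                  ≤⟨ *-monoʳ-≤ (x + y) (bernoulli x y h) ⟩
  (x + y) * (x + y) ^ suc h                                            ∎
  where
  open ≤-Reasoning
  X = x ^ h
  lem : ∀ x y X h → x * (x * X) + (2 + h) * (y * (x * X)) + (1 + h) * (y * (y * X)) ≡ (x + y) * (x * X + (1 + h) * (y * X))
  lem = solve-∀

-- By Bernoulli, (1 + 15/p)^h ≥ 1 + 15h/p ≥ 16 when p ≤ h. The exponent `e` has room for `j` blocks
-- of length `h`, each of which gains a factor 16.
decay-from : ∀ p h j e → 0 < h → p ≤ h → h * j ≤ e → 16 ^ j * p ^ e ≤ (p + 15) ^ e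
decay-from p h@(suc h′) j e _ p≤h hj≤e = begin
  16 ^ j * p ^ e                         ≡⟨ cong (λ z → 16 ^ j * p ^ z) (sym (m+[n∸m]≡n hj≤e)) ⟩
  16 ^ j * p ^ (h * j + r)               ≡⟨ cong (16 ^ j *_) (^-distribˡ-+-* p (h * j) r) ⟩
  16 ^ j * (p ^ (h * j) * p ^ r)         ≡⟨ *-assoc (16 ^ j) (p ^ (h * j)) (p ^ r) ⟨
  16 ^ j * p ^ (h * j) * p ^ r           ≡⟨ cong (λ z → 16 ^ j * z * p ^ r) (^-*-assoc p h j) ⟨
  16 ^ j * (p ^ h) ^ j * p ^ r           ≡⟨ cong (_* p ^ r) (^-distribʳ-* j 16 (p ^ h)) ⟨
  (16 * p ^ h) ^ j * p ^ r               ≤⟨ *-mono-≤ (^-monoˡ-≤ j block) (^-monoˡ-≤ r (m≤m+n p 15)) ⟩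
  ((p + 15) ^ h) ^ j * (p + 15) ^ r      ≡⟨ cong (_* (p + 15) ^ r) (^-*-assoc (p + 15) h j) ⟩
  (p + 15) ^ (h * j) * (p + 15) ^ r      ≡⟨ ^-distribˡ-+-* (p + 15) (h * j) r ⟨
  (p + 15) ^ (h * j + r)                 ≡⟨ cong ((p + 15) ^_) (m+[n∸m]≡n hj≤e) ⟩
  (p + 15) ^ e                           ∎
  where
  open ≤-Reasoning
  r = e ∸ h * j
  block : 16 * p ^ h ≤ (p + 15) ^ h
  block = begin
    16 * (p * p ^ h′)                          ≡⟨ lem p (p ^ h′) ⟩
    p * p ^ h′ + p * (15 * p ^ h′)             ≤⟨ +-monoʳ-≤ (p * p ^ h′) (*-monoˡ-≤ (15 * p ^ h′) p≤h) ⟩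
    p ^ suc h′ + suc h′ * (15 * p ^ h′)        ≤⟨ bernoulli p 15 h′ ⟩
    (p + 15) ^ suc h′                          ∎
    where
    lem : ∀ p q → 16 * (p * q) ≡ p * q + p * (15 * q)
    lem = solve-∀

-- Spans with coefficients -1, 0, 1 and binary expansion of multiples

module Spans {c ℓ : Level} (G : AbelianGroup c ℓ) where
  open AbelianGroup G renaming (Carrier to X; refl to ≈-refl; sym to ≈-sym; trans to ≈-trans)
  open AGProps G using (⁻¹-∙-comm; ε⁻¹≈ε; ⁻¹-involutive)
  open CSProps commutativeSemigroup using (interchange)
  open CMSum commutativeMonoid using () renaming (sum to ∑)

  mult-+ : ∀ a b x → mult G (a + b) x ≈ mult G a x ∙ mult G b x
  mult-+ zero    b x = ≈-sym (identityˡ _)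
  mult-+ (suc a) b x = ≈-trans (∙-congˡ (mult-+ a b x)) (≈-sym (assoc x _ _))

  mult-ε : ∀ a → mult G a ε ≈ ε
  mult-ε zero    = ≈-refl
  mult-ε (suc a) = ≈-trans (identityˡ _) (mult-ε a)

  mult-congʳ : ∀ a {x y} → x ≈ y → mult G a x ≈ mult G a y
  mult-congʳ zero    e = ≈-refl
  mult-congʳ (suc a) e = ∙-cong e (mult-congʳ a e)

  mult-congˡ : ∀ {a b} x → a ≡ b → mult G a x ≈ mult G b x
  mult-congˡ x refl = ≈-refl

  mult-∸ : ∀ {a b} x → b ≤ a → mult G a x ∙ mult G b x ⁻¹ ≈ mult G (a ∸ b) x
  mult-∸ {a} {b} x b≤a = ≈-trans (∙-congʳ (≈-trans (mult-congˡ x (sym (m∸n+n≡m b≤a))) (mult-+ (a ∸ b) b x)))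
    (≈-trans (assoc _ _ _) (≈-trans (∙-congˡ (inverseʳ _)) (identityʳ _)))

  mult-* : ∀ a b x → mult G (a * b) x ≈ mult G a (mult G b x)
  mult-* zero    b x = ≈-refl
  mult-* (suc a) b x = ≈-trans (mult-+ b (a * b) x) (∙-congˡ (mult-* a b x))

  quotient-∙ : ∀ x y x′ y′ → (x ∙ y) ∙ (x′ ∙ y′) ⁻¹ ≈ (x ∙ x′ ⁻¹) ∙ (y ∙ y′ ⁻¹)
  quotient-∙ x y x′ y′ = ≈-trans (∙-congˡ (≈-sym (⁻¹-∙-comm x′ y′))) (interchange x y (x′ ⁻¹) (y′ ⁻¹))

  InSpan-≈ : ∀ S {x y} → x ≈ y → InSpan G S y → InSpan G S x
  InSpan-≈ S x≈y (w , y≈) = w , ≈-trans x≈y y≈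

  InSpan-∷ : ∀ S {x} s c → InSpan G S x → InSpan G (c ∷ S) (signed G s c ∙ x)
  InSpan-∷ S s c (w , x≈) = s ∷ w , ∙-congˡ x≈

  InSpan-ε : ∀ S → InSpan G S ε
  InSpan-ε []      = [] , ≈-refl
  InSpan-ε (c ∷ S) = InSpan-≈ (c ∷ S) (≈-sym (identityˡ ε)) (InSpan-∷ S zer c (InSpan-ε S))

  InSpan-++ : ∀ S T {x y} → InSpan G S x → InSpan G T y → InSpan G (S ++ T) (x ∙ y)
  InSpan-++ []      T ([]    , x≈) hy = InSpan-≈ T (≈-trans (∙-congʳ x≈) (identityˡ _)) hy
  InSpan-++ (c ∷ S) T (s ∷ w , x≈) hy = InSpan-≈ (c ∷ S ++ T) (≈-trans (∙-congʳ x≈) (assoc _ _ _))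
                                          (InSpan-∷ (S ++ T) s c (InSpan-++ S T (w , ≈-refl) hy))

  InSpan-⁻¹ : ∀ S {x} → InSpan G S x → InSpan G S (x ⁻¹)
  InSpan-⁻¹ []      ([]    , x≈) = [] , ≈-trans (⁻¹-cong x≈) ε⁻¹≈ε
  InSpan-⁻¹ (c ∷ S) (s ∷ w , x≈) =
    InSpan-≈ (c ∷ S) (≈-trans (⁻¹-cong x≈) (≈-trans (≈-sym (⁻¹-∙-comm _ _)) (∙-congʳ (flip s))))
      (InSpan-∷ S (opposite s) c (InSpan-⁻¹ S (w , ≈-refl)))
    where
    opposite : Sign → Sign
    opposite neg = pos
    opposite zer = zer
    opposite pos = neg
    flip : ∀ s → signed G s c ⁻¹ ≈ signed G (opposite s) c
    flip neg = ⁻¹-involutive c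
    flip zer = ε⁻¹≈ε
    flip pos = ≈-refl

  InSpan-∈ : ∀ {S x} → x ∈ₗ S → InSpan G S x
  InSpan-∈ {x ∷ S} (here refl) = InSpan-≈ (x ∷ S) (≈-sym (identityʳ _)) (InSpan-∷ S pos x (InSpan-ε S))
  InSpan-∈ {c ∷ S} (there x∈S) = InSpan-≈ (c ∷ S) (≈-sym (identityˡ _)) (InSpan-∷ S zer c (InSpan-∈ x∈S))

  bits : ℕ → X → List X
  bits zero    x = []
  bits (suc β) x = x ∷ bits β (x ∙ x)

  length-bits : ∀ β x → length (bits β x) ≡ β
  length-bits zero    x = refl
  length-bits (suc β) x = cong suc (length-bits β (x ∙ x))

  InSpan-bits : ∀ β m x → m < 2 ^ β → InSpan G (bits β x) (mult G m x)
  InSpan-bits zero    zero    x _     = [] , ≈-refl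
  InSpan-bits zero    (suc m) x (s≤s ())
  InSpan-bits (suc β) m       x m<    =
    InSpan-≈ (bits (suc β) x) (≈-trans (mult-congˡ x (m≡m%n+[m/n]*n m 2)) (≈-trans (mult-+ (m % 2) (m / 2 * 2) x)
               (∙-cong (digit (m % 2) (m%n<n m 2))
                 (≈-trans (mult-* (m / 2) 2 x) (mult-congʳ (m / 2) (∙-congˡ (identityʳ x)))))))
      (InSpan-∷ (bits β (x ∙ x)) (sign (m % 2)) x (InSpan-bits β (m / 2) (x ∙ x)
        (*-cancelʳ-< 2 (m / 2) (2 ^ β) (≤-<-trans (≤-trans (m≤n+m (m / 2 * 2) (m % 2)) (≤-reflexive (sym (m≡m%n+[m/n]*n m 2))))
          (<-≤-trans m< (≤-reflexive (*-comm 2 (2 ^ β))))))))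
    where
    sign : ℕ → Sign
    sign zero    = zer
    sign (suc _) = pos
    digit : ∀ d → d < 2 → mult G d x ≈ signed G (sign d) x
    digit zero          _ = ≈-refl
    digit (suc zero)    _ = identityʳ x
    digit (suc (suc d)) (s≤s (s≤s ()))

  -- All that is asked of the digits of a kept colour. The two bounds of the theorem differ only in
  -- how this is established: by the size of the coefficients or by torsion.
  Digits : ℕ → ℕ → Set _
  Digits J β = ∀ x a b → a ≤ J → b ≤ J → InSpan G (bits β x) (mult G a x ∙ mult G b x ⁻¹)

  digits-bounded : ∀ J β → J < 2 ^ β → Digits J β
  digits-bounded J β J< x a b a≤J b≤J with ≤-total b a
  ... | inj₁ b≤a = InSpan-≈ (bits β x) (mult-∸ x b≤a) (InSpan-bits β (a ∸ b) x (≤-<-trans (≤-trans (m∸n≤m a b) a≤J) J<))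
  ... | inj₂ a≤b = InSpan-≈ (bits β x) (≈-trans (flip _ _) (⁻¹-cong (mult-∸ x a≤b)))
                     (InSpan-⁻¹ (bits β x) (InSpan-bits β (b ∸ a) x (≤-<-trans (≤-trans (m∸n≤m b a) b≤J) J<)))
    where
    flip : ∀ p q → p ∙ q ⁻¹ ≈ (q ∙ p ⁻¹) ⁻¹
    flip p q = ≈-sym (≈-trans (≈-sym (⁻¹-∙-comm q (p ⁻¹))) (≈-trans (∙-congˡ (⁻¹-involutive p)) (comm _ _)))

  -- Modulo r, the coefficient a - b is a + b(r - 1), and its residue is below r ≤ 2^β whatever the
  -- size of `a` and `b`.
  digits-torsion : ∀ r .{{_ : NonZero r}} J β → (∀ x → mult G r x ≈ ε) → r ≤ 2 ^ β → Digits J β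
  digits-torsion r@(suc r′) J β rx≈ε r≤ x a b _ _ =
    InSpan-≈ (bits β x) (≈-trans (∙-congˡ (≈-sym neg-b)) (≈-trans (≈-sym (mult-+ a (b * r′) x)) reduce))
      (InSpan-bits β (m % r) x (<-≤-trans (m%n<n m r) r≤))
    where
    m = a + b * r′
    kill : ∀ t → mult G (t * r) x ≈ ε
    kill t = ≈-trans (mult-* t r x) (≈-trans (mult-congʳ t (rx≈ε x)) (mult-ε t))
    neg-b : mult G (b * r′) x ≈ mult G b x ⁻¹
    neg-b = ≈-trans (≈-sym (identityˡ _)) (≈-trans (∙-congʳ (≈-sym (inverseˡ (mult G b x)))) (≈-trans (assoc _ _ _)
              (≈-trans (∙-congˡ (≈-trans (≈-sym (mult-+ b (b * r′) x)) (≈-trans (mult-congˡ x (sym (*-suc b r′))) (kill b)))) (identityʳ _))))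
    reduce : mult G m x ≈ mult G (m % r) x
    reduce = ≈-trans (mult-congˡ x (m≡m%n+[m/n]*n m r)) (≈-trans (mult-+ (m % r) (m / r * r) x) (≈-trans (∙-congˡ (kill (m / r))) (identityʳ _)))

  digitsOf : ℕ → ∀ {m} → (Fin m → X) → Vec Bool m → List X
  digitsOf β h []          = []
  digitsOf β h (true  ∷ f) = bits β (h zero) ++ digitsOf β (h ∘ suc) f
  digitsOf β h (false ∷ f) = digitsOf β (h ∘ suc) f

  length-digitsOf : ∀ β {m} (h : Fin m → X) f → length (digitsOf β h f) ≡ count (lookup f) * β
  length-digitsOf β h []          = refl
  length-digitsOf β h (true  ∷ f) = trans (length-++ (bits β (h zero))) (cong₂ _+_ (length-bits β (h zero)) (length-digitsOf β (h ∘ suc) f))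
  length-digitsOf β h (false ∷ f) = length-digitsOf β (h ∘ suc) f

  InSpan-digitsOf : ∀ J β → Digits J β → ∀ {m} (h : Fin m → X) (f : Vec Bool m) (a b : Fin m → ℕ) →
    (∀ v → a v ≤ J * χ (lookup f v)) → (∀ v → b v ≤ J * χ (lookup f v)) →
    InSpan G (digitsOf β h f) (∑ (λ v → mult G (a v) (h v)) ∙ ∑ (λ v → mult G (b v) (h v)) ⁻¹)
  InSpan-digitsOf J β dig h [] a b a≤ b≤ = InSpan-≈ [] (inverseʳ ε) ([] , ≈-refl)
  InSpan-digitsOf J β dig h (true ∷ f) a b a≤ b≤ =
    InSpan-≈ (digitsOf β h (true ∷ f)) (quotient-∙ _ _ _ _) (InSpan-++ (bits β (h zero)) (digitsOf β (h ∘ suc) f)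
      (dig (h zero) (a zero) (b zero) (≤-trans (a≤ zero) (≤-reflexive (*-identityʳ J))) (≤-trans (b≤ zero) (≤-reflexive (*-identityʳ J))))
      (InSpan-digitsOf J β dig (h ∘ suc) f (a ∘ suc) (b ∘ suc) (a≤ ∘ suc) (b≤ ∘ suc)))
  InSpan-digitsOf J β dig h (false ∷ f) a b a≤ b≤ =
    InSpan-≈ (digitsOf β (h ∘ suc) f) (∙-cong (drop a a≤) (⁻¹-cong (drop b b≤))) (InSpan-digitsOf J β dig (h ∘ suc) f (a ∘ suc) (b ∘ suc) (a≤ ∘ suc) (b≤ ∘ suc))
    where
    drop : (a : Fin (suc _) → ℕ) → (∀ v → a v ≤ J * χ (lookup (false ∷ f) v)) →
           mult G (a zero) (h zero) ∙ ∑ (λ v → mult G (a (suc v)) (h (suc v))) ≈ ∑ (λ v → mult G (a (suc v)) (h (suc v)))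
    drop a a≤ = ≈-trans (∙-congʳ (mult-congˡ (h zero) (n≤0⇒n≡0 (≤-trans (a≤ zero) (≤-reflexive (*-zeroʳ J)))))) (identityˡ _)

-- Coloured pairs and clusters of reachable vertices

module Colouring {c ℓ : Level} (G : AbelianGroup c ℓ)
  (n N : ℕ) (pt : Fin n → AbelianGroup.Carrier G) (g : Fin N → AbelianGroup.Carrier G)
  (col : Fin n → Fin n → Fin N)
  (col-injʳ : ∀ x {y y′} → col x y ≡ col x y′ → y ≡ y′)
  (pt-col : ∀ x y → AbelianGroup._≈_ G (pt y) (AbelianGroup._∙_ G (pt x) (g (col x y))))
  (θ : ℕ) (θ>0 : 0 < θ) (Nθ≤2n² : N * θ ≤ 2 * (n * n))
  (class≤θ : ∀ c → sum (λ x → count (λ y → c == col x y)) ≤ θ)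
  (col-injˡ : ∀ y {x x′} → col x y ≡ col x′ y → x ≡ x′)
  where

  open AbelianGroup G renaming (Carrier to X; refl to ≈-refl; sym to ≈-sym; trans to ≈-trans)
  open Spans G
  open CMSum commutativeMonoid using () renaming (sum to ∑; sum-cong-≋ to ∑-cong; ∑-distrib-+ to ∑-distrib-∙; sum-replicate-zero to ∑-ε)

  value : (Fin N → ℕ) → X
  value a = ∑ (λ v → mult G (a v) (g v))

  value-+ : ∀ a b → value (λ v → a v + b v) ≈ value a ∙ value b
  value-+ a b = ≈-trans (∑-cong (λ v → mult-+ (a v) (b v) (g v))) (∑-distrib-∙ (λ v → mult G (a v) (g v)) (λ v → mult G (b v) (g v)))

  value-0 : value (λ _ → 0) ≈ ε
  value-0 = ∑-ε N

  ∑-δ : ∀ {m} (h : Fin m → X) (v : Fin m) → ∑ (λ u → mult G (χ (u == v)) (h u)) ≈ h v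
  ∑-δ {suc m} h zero    = ≈-trans (∙-cong (identityʳ (h zero)) (∑-ε m)) (identityʳ (h zero))
  ∑-δ {suc m} h (suc v) = ≈-trans (identityˡ _) (∑-δ (h ∘ suc) v)

  -- Coefficients 0 and 1 suffice for a path of the exploration: a colour is read at most once, so
  -- it enters a path at most once.
  Word : (Fin N → Bool) → X → Set ℓ
  Word K e = ∃ λ a → (∀ v → a v ≤ χ (K v)) × e ≈ value a

  Word-ε : ∀ K → Word K ε
  Word-ε K = (λ _ → 0) , (λ _ → z≤n) , ≈-sym value-0

  Word-mono : ∀ {K K′ e} → (∀ v → K v ≡ true → K′ v ≡ true) → Word K e → Word K′ e
  Word-mono K⊆K′ (a , a≤ , e≈) = a , (λ v → ≤-trans (a≤ v) (χ-mono (K⊆K′ v))) , e≈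

  Word-insert : ∀ {K e} v → K v ≡ false → Word K e → Word (λ u → K u ∨ (u == v)) (e ∙ g v)
  Word-insert {K} {e} v Kv (a , a≤ , e≈) =
    (λ u → a u + χ (u == v)) , bound ,
    ≈-trans (∙-cong e≈ (≈-sym (∑-δ g v))) (≈-sym (value-+ a (λ u → χ (u == v))))
    where
    bound : ∀ u → a u + χ (u == v) ≤ χ (K u ∨ (u == v))
    bound u with u == v in u=v
    ... | false = ≤-trans (≤-reflexive (+-identityʳ (a u))) (≤-trans (a≤ u) (χ-mono {K u} ∨-introˡ))
    ... | true  = ≤-trans (+-monoˡ-≤ 1 (≤-trans (a≤ u) (≤-reflexive (cong χ (trans (cong K (==⇒≡ u v u=v)) Kv)))))
                          (≤-reflexive (cong χ (sym (∨-introʳ {K u} refl))))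

  -- A cluster of j vertices reachable from x: every colour v of one of its vertices leads on to τ v.
  record Cluster (K : Fin N → Bool) (x : Fin n) (τ : Fin N → Maybe (Fin n)) (j : ℕ) : Set (c ⊔ ℓ) where
    field
      fibres : ∀ b → count (λ v → hits (b ==_) (τ v)) ≤ j
      large  : 3 * n * j ≤ 4 * count (defined ∘ τ)
      reach  : ∀ v b → τ v ≡ just b → ∃ λ e → Word K e × pt b ≈ (pt x ∙ e) ∙ g v
  open Cluster

  -- The exploration from `x` has succeeded: a uniformly random colour belongs to the cluster with
  -- probability at least 1/16.
  record Live (K : Fin N → Bool) (x : Fin n) : Set (c ⊔ ℓ) where
    field
      {τ} : Fin N → Maybe (Fin n)
      {j} : ℕ
      cluster   : Cluster K x τ j
      saturated : N ≤ 16 * count (defined ∘ τ)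

  new : (Fin N → Maybe (Fin n)) → Fin n → ℕ
  new τ y = count (λ b → not (defined (τ (col y b))))

  fresh : (Fin N → Maybe (Fin n)) → Fin n → Bool
  fresh τ y = 3 * n ≤ᵇ 4 * new τ y

  add : Fin n → (Fin N → Maybe (Fin n)) → Fin N → Maybe (Fin n)
  add y τ c with τ c
  ... | just b  = just b
  ... | nothing with find (λ b → c == col y b)
  ...   | inj₁ (b , _) = just b
  ...   | inj₂ _       = nothing

  add-inv : ∀ y τ c b → add y τ c ≡ just b → τ c ≡ just b ⊎ c ≡ col y b
  add-inv y τ c b eq with τ c
  ... | just b′ = inj₁ eq
  ... | nothing with find (λ b → c == col y b) | eq
  ...   | inj₁ (b′ , p) | refl = inj₂ (==⇒≡ c (col y b′) p)
  ...   | inj₂ _        | ()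

  add-count : ∀ y τ → count (defined ∘ τ) + new τ y ≤ count (defined ∘ add y τ)
  add-count y τ = begin
    count (defined ∘ τ) + new τ y
      ≡⟨ cong (count (defined ∘ τ) +_) (sum-cong-≗ (λ b → sym (sum-δ (λ c → χ (not (defined (τ c)))) (col y b)))) ⟩
    count (defined ∘ τ) + sum (λ b → sum (λ c → χ (not (defined (τ c))) * χ (c == col y b)))
      ≡⟨ cong (count (defined ∘ τ) +_) (∑-comm (λ b c → χ (not (defined (τ c))) * χ (c == col y b))) ⟩
    count (defined ∘ τ) + sum (λ c → sum (λ b → χ (not (defined (τ c))) * χ (c == col y b)))
      ≡⟨ ∑-distrib-+ (χ ∘ defined ∘ τ) (λ c → sum (λ b → χ (not (defined (τ c))) * χ (c == col y b))) ⟨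
    sum (λ c → χ (defined (τ c)) + sum (λ b → χ (not (defined (τ c))) * χ (c == col y b)))
      ≤⟨ sum-mono pointwise ⟩
    count (defined ∘ add y τ) ∎
    where
    open ≤-Reasoning
    pointwise : ∀ c → χ (defined (τ c)) + sum (λ b → χ (not (defined (τ c))) * χ (c == col y b)) ≤ χ (defined (add y τ c))
    pointwise c with τ c
    ... | just b  = ≤-reflexive (cong suc (sum-replicate-zero n))
    ... | nothing with find (λ b → c == col y b)
    ...   | inj₁ (b , p)  = ≤-trans (≤-reflexive (sum-cong-≗ (λ b → +-identityʳ (χ (c == col y b)))))
              (count-unique (λ b → c == col y b)
                 (λ b b′ p p′ → col-injʳ y (trans (sym (==⇒≡ c _ p)) (==⇒≡ c _ p′))))
    ...   | inj₂ none = ≤-reflexive (sum-≗0 (λ b → trans (+-identityʳ (χ (c == col y b))) (cong χ (none b))))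

  add-cluster : ∀ {K K′ x τ j} y e → (∀ v → K v ≡ true → K′ v ≡ true) →
                Word K′ e → pt y ≈ pt x ∙ e → 3 * n ≤ 4 * new τ y →
                Cluster K x τ j → Cluster K′ x (add y τ) (suc j)
  add-cluster {K} {K′} {x} {τ} {j} y e K⊆K′ we y≈ fr C = record
    { fibres = λ b → ≤-trans (count≤+ (λ v → hits (b ==_) (add y τ v)) (λ v → hits (b ==_) (τ v)) (λ v → v == col y b) (fib b))
                       (≤-trans (+-mono-≤ (fibres C b) (≤-reflexive (sum-χ-== (col y b)))) (≤-reflexive (+-comm j 1)))
    ; large  = begin
        3 * n * suc j                                  ≡⟨ *-suc (3 * n) j ⟩
        3 * n + 3 * n * j                              ≤⟨ +-mono-≤ fr (large C) ⟩
        4 * new τ y + 4 * count (defined ∘ τ)          ≡⟨ *-distribˡ-+ 4 (new τ y) (count (defined ∘ τ)) ⟨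
        4 * (new τ y + count (defined ∘ τ))            ≡⟨ cong (4 *_) (+-comm (new τ y) (count (defined ∘ τ))) ⟩
        4 * (count (defined ∘ τ) + new τ y)            ≤⟨ *-monoʳ-≤ 4 (add-count y τ) ⟩
        4 * count (defined ∘ add y τ)                  ∎
    ; reach  = reach′ }
    where
    open ≤-Reasoning
    fib : ∀ b v → hits (b ==_) (add y τ v) ≡ true → hits (b ==_) (τ v) ≡ true ⊎ (v == col y b) ≡ true
    fib b v h with add y τ v in eq
    ... | just b′ with ==⇒≡ b b′ h
    ...   | refl with add-inv y τ v b eq
    ...     | inj₁ p = inj₁ (trans (cong (hits (b ==_)) p) (==-refl b))
    ...     | inj₂ p = inj₂ (subst (λ z → (v == z) ≡ true) p (==-refl v))
    reach′ : ∀ v b → add y τ v ≡ just b → ∃ λ e → Word K′ e × pt b ≈ (pt x ∙ e) ∙ g v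
    reach′ v b eq with add-inv y τ v b eq
    ... | inj₁ p = let e , w , q = reach C v b p in e , Word-mono K⊆K′ w , q
    ... | inj₂ refl = e , we , ≈-trans (pt-col y b) (∙-congʳ y≈)

  -- A vertex that is not fresh has more than n/4 of its colours in the domain of `τ`. Half of the
  -- vertices thus give n²/8 pairs, while a colour accounts for at most θ pairs, and Nθ/16 ≤ n²/8.
  saturation : ∀ τ → n ≤ 2 * count (not ∘ fresh τ) → N ≤ 16 * count (defined ∘ τ)
  saturation τ h = *-cancelʳ-≤ N _ θ {{>-nonZero θ>0}} (begin
    N * θ                                        ≤⟨ Nθ≤2n² ⟩
    2 * (n * n)                                  ≤⟨ *-monoʳ-≤ 2 (*-monoʳ-≤ n h) ⟩
    2 * (n * (2 * S))                            ≡⟨ lem n S ⟩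
    4 * (n * S)                                  ≡⟨ cong (4 *_) (*-distribˡ-sum n (χ ∘ not ∘ fresh τ)) ⟩
    4 * sum (λ y → n * χ (not (fresh τ y)))      ≤⟨ *-monoʳ-≤ 4 (sum-mono stale-old) ⟩
    4 * sum (λ y → 4 * old y)                    ≡⟨ cong (4 *_) (*-distribˡ-sum 4 old) ⟨
    4 * (4 * sum old)                            ≤⟨ *-monoʳ-≤ 4 (*-monoʳ-≤ 4 old≤) ⟩
    4 * (4 * (count (defined ∘ τ) * θ))          ≡⟨ lem′ (count (defined ∘ τ)) θ ⟩
    16 * count (defined ∘ τ) * θ                 ∎)
    where
    open ≤-Reasoning
    S = count (not ∘ fresh τ)
    old : Fin n → ℕ
    old y = count (λ b → defined (τ (col y b)))
    lem : ∀ n s → 2 * (n * (2 * s)) ≡ 4 * (n * s)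
    lem = solve-∀
    lem′ : ∀ d t → 4 * (4 * (d * t)) ≡ 16 * d * t
    lem′ = solve-∀
    stale-old : ∀ y → n * χ (not (fresh τ y)) ≤ 4 * old y
    stale-old y with fresh τ y in fr
    ... | true  = ≤-trans (≤-reflexive (*-zeroʳ n)) z≤n
    ... | false = +-cancelʳ-≤ (4 * new τ y) _ _ (begin
        n * 1 + 4 * new τ y           ≤⟨ +-mono-≤ (≤-reflexive (*-identityʳ n)) (<⇒≤ (≤ᵇ-false (3 * n) _ fr)) ⟩
        n + 3 * n                     ≡⟨ cong (4 *_) (sym (count-not (λ b → defined (τ (col y b))))) ⟩
        4 * (old y + new τ y)         ≡⟨ *-distribˡ-+ 4 (old y) (new τ y) ⟩
        4 * old y + 4 * new τ y       ∎)
    old≤ : sum old ≤ count (defined ∘ τ) * θ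
    old≤ = begin
      sum (λ y → sum (λ b → χ (defined (τ (col y b)))))
        ≡⟨ sum-cong-≗ (λ y → sum-cong-≗ (λ b → sym (sum-δ (χ ∘ defined ∘ τ) (col y b)))) ⟩
      sum (λ y → sum (λ b → sum (λ c → D c * χ (c == col y b))))
        ≡⟨ sum-cong-≗ (λ y → ∑-comm (λ b c → D c * χ (c == col y b))) ⟩
      sum (λ y → sum (λ c → sum (λ b → D c * χ (c == col y b))))
        ≡⟨ ∑-comm (λ y c → sum (λ b → D c * χ (c == col y b))) ⟩
      sum (λ c → sum (λ y → sum (λ b → D c * χ (c == col y b))))
        ≡⟨ sum-cong-≗ (λ c → sum-cong-≗ (λ y → sym (*-distribˡ-sum (D c) (λ b → χ (c == col y b))))) ⟩
      sum (λ c → sum (λ y → D c * count (λ b → c == col y b)))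
        ≡⟨ sum-cong-≗ (λ c → sym (*-distribˡ-sum (D c) (λ y → count (λ b → c == col y b)))) ⟩
      sum (λ c → D c * sum (λ y → count (λ b → c == col y b)))
        ≤⟨ sum-mono (λ c → *-monoʳ-≤ (D c) (class≤θ c)) ⟩
      sum (λ c → D c * θ)
        ≡⟨ sum-cong-≗ (λ c → *-comm (D c) θ) ⟩
      sum (λ c → θ * D c)
        ≡⟨ *-distribˡ-sum θ D ⟨
      θ * count (defined ∘ τ)
        ≡⟨ *-comm θ (count (defined ∘ τ)) ⟩
      count (defined ∘ τ) * θ ∎
      where
      D : Fin N → ℕ
      D c = χ (defined (τ c))

  -- The exploration and its failure probability

  module Exploration (l : ℕ) (64L≤n : 64 * suc l ≤ n) where
    open Expectation l

    -- One reading multiplies 16⁻ʲ by 1/16 with probability 1/(1 + l) and by 1 otherwise, hence on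
    -- average by p₀/(16(1 + l)). The denominator appears below as p₀ + 15.
    p₀ : ℕ
    p₀ = suc (16 * l)

    -- The constant 64 is 4 · 16: with nj ≤ 4e it provides 16(1 + l) ≥ p₀ read bits per visited
    -- vertex, that is, a block of `decay-from` for each of them.
    decay : ∀ j e → n * j ≤ 4 * e → 16 ^ j * p₀ ^ e ≤ (p₀ + 15) ^ e
    decay j e nj≤4e = decay-from p₀ (16 * suc l) j e (s≤s z≤n) p₀≤h (*-cancelˡ-≤ 4 (begin
        4 * (16 * suc l * j)   ≡⟨ lem l j ⟩
        64 * suc l * j         ≤⟨ *-monoˡ-≤ j 64L≤n ⟩
        n * j                  ≤⟨ nj≤4e ⟩
        4 * e                  ∎))
      where
      open ≤-Reasoning
      lem : ∀ l j → 4 * (16 * (1 + l) * j) ≡ 64 * (1 + l) * j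
      lem = solve-∀
      p₀≤h : p₀ ≤ 16 * suc l
      p₀≤h = ≤-trans (+-monoˡ-≤ (16 * l) {1} {16} (s≤s z≤n)) (≤-reflexive (sym (*-suc 16 l)))

    -- An adaptive exploration of kept colours that has already read the bits in Rev (found K among
    -- them kept) and visited j vertices.  Its failure probability is bounded by the potential
    -- 16⁻ʲ (16 (1 + l) / p₀)ᵉ, e = |Rev|: reading a bit does not increase the expected potential.
    Outcome : Fin n → (Rev K : Fin N → Bool) → ℕ → Set (c ⊔ ℓ)
    Outcome x Rev K j = Σ (Vec Bool N → Bool) λ dead →
      (∀ v → Rev v ≡ true → ∀ f b → dead (f [ v ]≔ b) ≡ dead f) ×
      𝔼 (χ ∘ dead) * (16 ^ j * p₀ ^ count Rev) ≤ suc l ^ N * (p₀ + 15) ^ count Rev ×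
      (∀ f → (∀ v → K v ≡ true → lookup f v ≡ true) → dead f ≡ false → Live (lookup f) x)

    -- The supermartingale step, cleared of denominators. Both branches have the same right-hand
    -- side; their weights 1 and 16l add up to `p₀`, and p₀ + 15 = 16(1 + l).
    combine-bounds : ∀ E E₁ E₀ Q T B → suc l * E ≡ E₁ + l * E₀ →
      E₁ * (16 * Q * p₀) ≤ T * ((p₀ + 15) * B) → E₀ * (Q * p₀) ≤ T * ((p₀ + 15) * B) → E * Q ≤ T * B
    combine-bounds E E₁ E₀ Q T B eq h₁ h₀ = *-cancelʳ-≤ (E * Q) (T * B) (16 * suc l * p₀) (begin
      E * Q * (16 * suc l * p₀)                         ≡⟨ r₁ E Q l p₀ ⟩
      suc l * E * (16 * Q * p₀)                         ≡⟨ cong (_* (16 * Q * p₀)) eq ⟩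
      (E₁ + l * E₀) * (16 * Q * p₀)                     ≡⟨ r₂ E₁ E₀ Q l p₀ ⟩
      E₁ * (16 * Q * p₀) + 16 * l * (E₀ * (Q * p₀))     ≤⟨ +-mono-≤ h₁ (*-monoʳ-≤ (16 * l) h₀) ⟩
      C + 16 * l * C                                    ≡⟨ r₃ T B l ⟩
      T * B * (16 * suc l * p₀)                         ∎)
      where
      open ≤-Reasoning
      C = T * ((p₀ + 15) * B)
      r₁ : ∀ E Q l p → E * Q * (16 * (1 + l) * p) ≡ (1 + l) * E * (16 * Q * p)
      r₁ = solve-∀
      r₂ : ∀ a b Q l p → (a + l * b) * (16 * Q * p) ≡ a * (16 * Q * p) + 16 * l * (b * (Q * p))
      r₂ = solve-∀
      r₃ : ∀ T B l → T * ((1 + 16 * l + 15) * B) + 16 * l * (T * ((1 + 16 * l + 15) * B)) ≡ T * B * (16 * (1 + l) * (1 + 16 * l))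
      r₃ = solve-∀

    -- Reading stops when every unread colour of the cluster leads to a vertex that is not fresh.
    -- Then either half of all vertices are not fresh and the cluster is saturated, or many colours
    -- were read for few visited vertices, and the outcome is declared dead. The fuel bounds the
    -- number of unread colours.
    explore : ∀ fuel x τ Rev K j → N ≤ count Rev + fuel → (∀ v → K v ≡ true → Rev v ≡ true) →
              Cluster K x τ j → Outcome x Rev K j
    explore fuel x τ Rev K j N≤ K⊆R C with find (λ v → not (Rev v) ∧ hits (fresh τ) (τ v))
    ... | inj₂ none with n ≤ᵇ 2 * count (not ∘ fresh τ) in sat
    ...   | true  = (λ _ → false) , (λ _ _ _ _ → refl) ,
                    ≤-trans (≤-reflexive (cong (_* (16 ^ j * p₀ ^ count Rev)) (𝔼-const N 0))) z≤n ,
                    λ f K⊆f _ → record { cluster = record { fibres = fibres C ; large = large C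
                                           ; reach = λ v b eq → let e , w , q = reach C v b eq in e , Word-mono K⊆f w , q }
                                       ; saturated = saturation τ (≤ᵇ-true n _ sat) }
    ...   | false = (λ _ → true) , (λ _ _ _ _ → refl) ,
                    ≤-trans (≤-reflexive (cong (_* (16 ^ j * p₀ ^ count Rev)) (trans (𝔼-const N 1) (*-identityˡ (suc l ^ N)))))
                            (*-monoʳ-≤ (suc l ^ N) (decay j (count Rev) nj≤4e)) ,
                    λ _ _ ()
      where
      open ≤-Reasoning
      S = count (not ∘ fresh τ)
      split : ∀ v → defined (τ v) ≡ true → Rev v ≡ true ⊎ hits (not ∘ fresh τ) (τ v) ≡ true
      split v d with τ v | Rev v | none v
      ... | just b | true  | _ = inj₁ refl
      ... | just b | false | q = inj₂ (cong not q)
      D≤ : count (defined ∘ τ) ≤ count Rev + j * S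
      D≤ = ≤-trans (count≤+ (defined ∘ τ) Rev (λ v → hits (not ∘ fresh τ) (τ v)) split)
                   (+-monoʳ-≤ (count Rev) (count-fibres τ (not ∘ fresh τ) j (fibres C)))
      -- Fewer than n/2 vertices are not fresh, and they are the targets of at most jn/2 colours.
      -- The cluster has at least 3nj/4, so nj/4 or more have been read.
      nj≤4e : n * j ≤ 4 * count Rev
      nj≤4e = +-cancelʳ-≤ (2 * (n * j)) _ _ (begin
        n * j + 2 * (n * j)              ≡⟨ r₁ n j ⟩
        3 * n * j                        ≤⟨ large C ⟩
        4 * count (defined ∘ τ)          ≤⟨ *-monoʳ-≤ 4 D≤ ⟩
        4 * (count Rev + j * S)          ≡⟨ r₂ (count Rev) j S ⟩
        4 * count Rev + 2 * (j * (2 * S)) ≤⟨ +-monoʳ-≤ (4 * count Rev) (*-monoʳ-≤ 2 (*-monoʳ-≤ j (<⇒≤ (≤ᵇ-false n _ sat)))) ⟩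
        4 * count Rev + 2 * (j * n)      ≡⟨ cong (λ z → 4 * count Rev + 2 * z) (*-comm j n) ⟩
        4 * count Rev + 2 * (n * j)      ∎)
        where
        r₁ : ∀ n j → n * j + 2 * (n * j) ≡ 3 * n * j
        r₁ = solve-∀
        r₂ : ∀ e j s → 4 * (e + j * s) ≡ 4 * e + 2 * (j * (2 * s))
        r₂ = solve-∀
    explore zero x τ Rev K j N≤ K⊆R C | inj₁ (v , p) =
      ⊥-elim (<-irrefl refl (<-≤-trans (≤-<-trans N≤ (subst (_< suc (count Rev)) (sym (+-identityʳ (count Rev))) ≤-refl))
        (subst (_≤ N) (count-insert Rev v (not-true (proj₁ (∧-elim p)))) (count≤ (λ u → Rev u ∨ (u == v))))))
    explore (suc fuel) x τ Rev K j N≤ K⊆R C | inj₁ (v , p) = query (τ v) refl (proj₂ (∧-elim p))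
      where
      Rv : Rev v ≡ false
      Rv = not-true (proj₁ (∧-elim p))
      Kv : K v ≡ false
      Kv with K v in eq
      ... | false = refl
      ... | true  = true≢false (K⊆R v eq) Rv
      Rev′ K′ : Fin N → Bool
      Rev′ u = Rev u ∨ (u == v)
      K′ u = K u ∨ (u == v)
      e≡ : count Rev′ ≡ suc (count Rev)
      e≡ = count-insert Rev v Rv
      N≤′ : N ≤ count Rev′ + fuel
      N≤′ = ≤-trans N≤ (≤-reflexive (trans (+-suc (count Rev) fuel) (cong (_+ fuel) (sym e≡))))
      query : ∀ m → τ v ≡ m → hits (fresh τ) m ≡ true → Outcome x Rev K j
      query (just y) τv fr with reach C v y τv
      ... | e , we , y≈ = dead , indep , bound , live
        where
        out₁ : Outcome x Rev′ K′ (suc j)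
        out₁ = explore fuel x (add y τ) Rev′ K′ (suc j) N≤′ K′⊆R′
                 (add-cluster y (e ∙ g v) (λ u → ∨-introˡ) (Word-insert v Kv we) (≈-trans y≈ (assoc _ _ _))
                    (≤ᵇ-true (3 * n) _ fr) C)
          where
          K′⊆R′ : ∀ u → K′ u ≡ true → Rev′ u ≡ true
          K′⊆R′ u q with ∨-elim {K u} q
          ... | inj₁ Ku  = ∨-introˡ (K⊆R u Ku)
          ... | inj₂ u=v = ∨-introʳ {Rev u} u=v
        out₀ : Outcome x Rev′ K j
        out₀ = explore fuel x τ Rev′ K j N≤′ (λ u q → ∨-introˡ (K⊆R u q)) C
        d₁ = proj₁ out₁
        d₀ = proj₁ out₀
        dead : Vec Bool N → Bool
        dead f = if lookup f v then d₁ f else d₀ f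
        Rv′ : Rev′ v ≡ true
        Rv′ = ∨-introʳ {Rev v} (==-refl v)
        indep : ∀ u → Rev u ≡ true → ∀ f b → dead (f [ u ]≔ b) ≡ dead f
        indep u Ru f b
          rewrite lookup∘update′ {i = v} {j = u} (λ v≡u → true≢false (trans (cong Rev v≡u) Ru) Rv) f b
                | proj₁ (proj₂ out₁) u (∨-introˡ Ru) f b | proj₁ (proj₂ out₀) u (∨-introˡ Ru) f b = refl
        χ-if : ∀ b {x y} → χ (if b then x else y) ≡ (if b then χ x else χ y)
        χ-if true  = refl
        χ-if false = refl
        bound : 𝔼 (χ ∘ dead) * (16 ^ j * p₀ ^ count Rev) ≤ suc l ^ N * (p₀ + 15) ^ count Rev
        bound = combine-bounds (𝔼 (χ ∘ dead)) (𝔼 (χ ∘ d₁)) (𝔼 (χ ∘ d₀)) (16 ^ j * p₀ ^ count Rev) (suc l ^ N) ((p₀ + 15) ^ count Rev)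
          (trans (cong (suc l *_) (𝔼-cong {N} (λ f → χ-if (lookup f v))))
                 -- Both continuations count `v` as read, so their failure events ignore this bit;
                 -- that is the independence needed here.
                 (𝔼-query v (χ ∘ d₁) (χ ∘ d₀) (λ f b → cong χ (proj₁ (proj₂ out₁) v Rv′ f b)) (λ f b → cong χ (proj₁ (proj₂ out₀) v Rv′ f b))))
          (subst₂ _≤_ (cong (𝔼 (χ ∘ d₁) *_) (trans (cong (λ z → 16 ^ suc j * p₀ ^ z) e≡) (r₁ (16 ^ j) p₀ (p₀ ^ count Rev))))
                      (cong (λ z → suc l ^ N * (p₀ + 15) ^ z) e≡) (proj₁ (proj₂ (proj₂ out₁))))
          (subst₂ _≤_ (cong (𝔼 (χ ∘ d₀) *_) (trans (cong (λ z → 16 ^ j * p₀ ^ z) e≡) (r₂ (16 ^ j) p₀ (p₀ ^ count Rev))))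
                      (cong (λ z → suc l ^ N * (p₀ + 15) ^ z) e≡) (proj₁ (proj₂ (proj₂ out₀))))
          where
          r₁ : ∀ a p q → 16 * a * (p * q) ≡ 16 * (a * q) * p
          r₁ = solve-∀
          r₂ : ∀ a p q → a * (p * q) ≡ a * q * p
          r₂ = solve-∀
        live : ∀ f → (∀ u → K u ≡ true → lookup f u ≡ true) → dead f ≡ false → Live (lookup f) x
        live f K⊆f df with lookup f v in fv
        ... | false = proj₂ (proj₂ (proj₂ out₀)) f K⊆f df
        ... | true  = proj₂ (proj₂ (proj₂ out₁)) f K′⊆f df
          where
          K′⊆f : ∀ u → K′ u ≡ true → lookup f u ≡ true
          K′⊆f u q with ∨-elim {K u} q
          ... | inj₁ Ku  = K⊆f u Ku
          ... | inj₂ u=v = trans (cong (lookup f) (==⇒≡ u v u=v)) fv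

  -- Choice of the kept colours

  module Sampling (l : ℕ) (64L≤n : 64 * suc l ≤ n) (B : ℕ) (B>0 : 0 < B) (N≤BL : N ≤ B * suc l) where
    open Expectation l
    open Exploration l 64L≤n

    empty-cluster : ∀ x → Cluster (λ _ → false) x (λ _ → nothing) 0
    empty-cluster x = record
      { fibres = λ b → ≤-reflexive (sum-replicate-zero N)
      ; large  = ≤-trans (≤-reflexive (*-zeroʳ (3 * n))) z≤n
      ; reach  = λ _ _ () }

    abstract
      outcome : ∀ x → Outcome x (λ _ → false) (λ _ → false) 1
      outcome x = explore N x (add x (λ _ → nothing)) (λ _ → false) (λ _ → false) 1 (m≤n+m N _) (λ _ p → p)
        (add-cluster x ε (λ _ p → p) (Word-ε _) (≈-sym (identityʳ (pt x)))
          (≤-trans (*-monoˡ-≤ n (n≤1+n 3)) (≤-reflexive (cong (4 *_) (sym (count-full {n} (λ _ → true) (λ _ → refl))))))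
          (empty-cluster x))

    dead : Fin n → Vec Bool N → Bool
    dead x = proj₁ (outcome x)

    -- With `x` as the only visited vertex and no bit read, the potential is 1/16.
    𝔼-dead : ∀ x → 16 * 𝔼 (χ ∘ dead x) ≤ suc l ^ N
    𝔼-dead x = begin
      16 * 𝔼 (χ ∘ dead x)           ≡⟨ *-comm 16 (𝔼 (χ ∘ dead x)) ⟩
      𝔼 (χ ∘ dead x) * (16 ^ 1 * p₀ ^ 0) ≡⟨ cong (λ z → 𝔼 (χ ∘ dead x) * (16 ^ 1 * p₀ ^ z)) (sum-replicate-zero N) ⟨
      𝔼 (χ ∘ dead x) * (16 ^ 1 * p₀ ^ count {N} (λ _ → false)) ≤⟨ proj₁ (proj₂ (proj₂ (outcome x))) ⟩
      suc l ^ N * (p₀ + 15) ^ count {N} (λ _ → false) ≡⟨ cong (λ z → suc l ^ N * (p₀ + 15) ^ z) (sum-replicate-zero N) ⟩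
      suc l ^ N * 1                 ≡⟨ *-identityʳ (suc l ^ N) ⟩
      suc l ^ N                     ∎
      where open ≤-Reasoning

    -- The weights give both terms mean at most Bn: each of n vertices is dead with probability at
    -- most 1/16, and N/(1 + l) ≤ B colours are kept on average. A value of at most 2Bn therefore
    -- allows n/8 dead vertices and 2B kept colours.
    cost : Vec Bool N → ℕ
    cost f = 16 * B * sum (λ x → χ (dead x f)) + n * sum (λ v → χ (lookup f v))

    𝔼-cost : 𝔼 cost ≤ 2 * (B * n) * suc l ^ N
    𝔼-cost = begin
      𝔼 cost
        ≡⟨ 𝔼-+ {N} (λ f → 16 * B * sum (λ x → χ (dead x f))) (λ f → n * sum (λ v → χ (lookup f v))) ⟩
      𝔼 {N} (λ f → 16 * B * sum (λ x → χ (dead x f))) + 𝔼 {N} (λ f → n * sum (λ v → χ (lookup f v)))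
        ≡⟨ cong₂ _+_ (𝔼-* {N} (16 * B) (λ f → sum (λ x → χ (dead x f)))) (𝔼-* {N} n (λ f → sum (λ v → χ (lookup f v)))) ⟩
      16 * B * 𝔼 {N} (λ f → sum (λ x → χ (dead x f))) + n * 𝔼 {N} (λ f → sum (λ v → χ (lookup f v)))
        ≡⟨ cong₂ (λ a b → 16 * B * a + n * b) (𝔼-sum (λ x f → χ (dead x f))) (𝔼-sum {N} {N} (λ v f → χ (lookup f v))) ⟩
      16 * B * sum (λ x → 𝔼 (χ ∘ dead x)) + n * sum (λ v → 𝔼 {N} (λ f → χ (lookup f v)))
        ≤⟨ +-mono-≤ deads (*-monoʳ-≤ n few-bits) ⟩
      B * (n * T′) + n * (B * T′)
        ≡⟨ r B n T′ ⟩
      2 * (B * n) * T′ ∎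
      where
      open ≤-Reasoning
      T′ = suc l ^ N
      r : ∀ B n t → B * (n * t) + n * (B * t) ≡ 2 * (B * n) * t
      r = solve-∀
      r₁ : ∀ B s → 16 * B * s ≡ B * (16 * s)
      r₁ = solve-∀
      deads : 16 * B * sum (λ x → 𝔼 (χ ∘ dead x)) ≤ B * (n * T′)
      deads = begin
        16 * B * sum (λ x → 𝔼 (χ ∘ dead x))      ≡⟨ r₁ B (sum (λ x → 𝔼 (χ ∘ dead x))) ⟩
        B * (16 * sum (λ x → 𝔼 (χ ∘ dead x)))    ≡⟨ cong (B *_) (*-distribˡ-sum 16 (λ x → 𝔼 (χ ∘ dead x))) ⟩
        B * sum (λ x → 16 * 𝔼 (χ ∘ dead x))      ≤⟨ *-monoʳ-≤ B (sum-mono 𝔼-dead) ⟩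
        B * sum {n} (λ _ → T′)                   ≡⟨ cong (B *_) (sum-const n T′) ⟩
        B * (n * T′)                             ∎
      few-bits : sum (λ v → 𝔼 {N} (λ f → χ (lookup f v))) ≤ B * T′
      few-bits = *-cancelˡ-≤ (suc l) (begin
        suc l * sum (λ v → 𝔼 {N} (λ f → χ (lookup f v)))     ≡⟨ *-distribˡ-sum (suc l) (λ v → 𝔼 {N} (λ f → χ (lookup f v))) ⟩
        sum (λ v → suc l * 𝔼 {N} (λ f → χ (lookup f v)))     ≡⟨ sum-cong-≗ {N} (λ v → 𝔼-bit v) ⟩
        sum {N} (λ _ → T′)                                   ≡⟨ sum-const N T′ ⟩
        N * T′                                               ≤⟨ *-monoˡ-≤ T′ N≤BL ⟩
        B * suc l * T′                                       ≡⟨ r₂ B (suc l) T′ ⟩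
        suc l * (B * T′)                                     ∎)
        where
        r₂ : ∀ b l t → b * l * t ≡ l * (b * t)
        r₂ = solve-∀

    record Kept : Set (c ⊔ ℓ) where
      field
        kept       : Vec Bool N
        kept-few   : count (lookup kept) ≤ 2 * B
        live?      : ∀ x → Maybe (Live (lookup kept) x)
        mostlyLive : 8 * count (λ x → not (maybe′ (λ _ → true) false (live? x))) ≤ n

    cheap : ∀ f → cost f ≤ 2 * (B * n) → Kept
    cheap f cost≤ = record
      { kept = f
      ; kept-few = *-cancelˡ-≤ n {{n≢0}} (≤-trans (m≤n+m keeps deads) (≤-trans cost≤ (≤-reflexive (r n B))))
      ; live? = λ x → decide x (dead x f) refl
      ; mostlyLive = *-cancelˡ-≤ (2 * B) {{2B≢0}} (begin
          2 * B * (8 * count (λ x → not (maybe′ (λ _ → true) false (decide x (dead x f) refl))))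
            ≡⟨ cong (λ z → 2 * B * (8 * z)) (sum-cong-≗ (λ x → cong χ (flag x (dead x f) refl))) ⟩
          2 * B * (8 * sum (λ x → χ (dead x f)))   ≡⟨ r₁ B (sum (λ x → χ (dead x f))) ⟩
          deads                                    ≤⟨ m≤m+n deads keeps ⟩
          cost f                                   ≤⟨ cost≤ ⟩
          2 * (B * n)                              ≡⟨ *-assoc 2 B n ⟨
          2 * B * n                                ∎) }
      where
      open ≤-Reasoning
      deads keeps : ℕ
      deads = 16 * B * sum (λ x → χ (dead x f))
      keeps = n * sum (λ v → χ (lookup f v))
      n≢0 : NonZero n
      n≢0 = >-nonZero (≤-trans (s≤s z≤n) 64L≤n)
      2B≢0 : NonZero (2 * B)
      2B≢0 = >-nonZero (≤-trans B>0 (m≤m+n B (B + 0)))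
      r : ∀ n B → 2 * (B * n) ≡ n * (2 * B)
      r = solve-∀
      r₁ : ∀ B s → 2 * B * (8 * s) ≡ 16 * B * s
      r₁ = solve-∀
      decide : ∀ x b → dead x f ≡ b → Maybe (Live (lookup f) x)
      decide x true  _  = nothing
      decide x false eq = just (proj₂ (proj₂ (proj₂ (outcome x))) f (λ _ ()) eq)
      flag : ∀ x b eq → not (maybe′ (λ _ → true) false (decide x b eq)) ≡ b
      flag x true  _ = refl
      flag x false _ = refl

    sample : Kept
    sample = let f , cost≤ = 𝔼-witness cost (2 * (B * n)) 𝔼-cost in cheap f cost≤

  -- Epochs enlarging the reachable sets until a hub appears

  module Growth (K : Fin N → Bool) (n>0 : 0 < n) (live? : ∀ x → Maybe (Live K x))
                (mostlyLive : 8 * count (λ x → not (maybe′ (λ _ → true) false (live? x))) ≤ n) where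

    subval : (vs : List (Fin N)) → Vec Bool (length vs) → X
    subval []       []       = ε
    subval (v ∷ vs) (b ∷ bs) = (if b then g v else ε) ∙ subval vs bs

    -- The values of concatenated paths, each ending in its own extra colour. A path uses a kept
    -- colour at most once, so the number of extra colours bounds every multiplicity.
    Box : List (Fin N) → X → Set ℓ
    Box vs e = Σ (Fin N → ℕ) λ a → Σ (Vec Bool (length vs)) λ bs →
               (∀ v → a v ≤ length vs * χ (K v)) × e ≈ value a ∙ subval vs bs

    Box-ε : Box [] ε
    Box-ε = (λ _ → 0) , [] , (λ _ → z≤n) , ≈-sym (≈-trans (identityʳ _) value-0)

    Box-skip : ∀ {vs e} v → Box vs e → Box (v ∷ vs) e
    Box-skip {vs} v (a , bs , a≤ , e≈) = a , false ∷ bs , (λ u → ≤-trans (a≤ u) (m≤n+m _ (χ (K u)))) ,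
      ≈-trans e≈ (∙-congˡ (≈-sym (identityˡ _)))

    Box-step : ∀ {vs e w} v → Word K w → Box vs e → Box (v ∷ vs) ((w ∙ g v) ∙ e)
    Box-step {vs} {e} {w} v (a′ , a′≤ , w≈) (a , bs , a≤ , e≈) =
      (λ u → a′ u + a u) , true ∷ bs , (λ u → +-mono-≤ (a′≤ u) (a≤ u)) ,
      ≈-trans (∙-cong (∙-congʳ w≈) e≈) (≈-trans (interchange (value a′) (g v) (value a) (subval vs bs)) (∙-congʳ (≈-sym (value-+ a′ a))))
      where open CSProps commutativeSemigroup using (interchange)

    Reaches : List (Fin N) → Fin n → Fin n → Set (c ⊔ ℓ)
    Reaches vs x u = ∃ λ e → Box vs e × pt u ≈ pt x ∙ e

    -- The list `vs` is common to all starting vertices, so that each new colour has to help a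
    -- positive proportion of them at once.
    record Family (k : ℕ) : Set (c ⊔ ℓ) where
      field
        vs    : List (Fin N)
        short : length vs ≤ 512 * k
        good  : Fin n → Bool
        many  : 4 * count (not ∘ good) ≤ n
        R     : Fin n → Fin n → Bool
        size  : ∀ x → good x ≡ true → 3 ^ k ≤ 2 ^ k * count (R x)
        reachable : ∀ x u → good x ≡ true → R x u ≡ true → Reaches vs x u

    record Hub (k : ℕ) : Set (c ⊔ ℓ) where
      field
        vs    : List (Fin N)
        short : length vs ≤ 512 * k
        u     : Fin n
        Z     : Fin n → Bool
        dense : n ≤ 16 * count Z
        reachable : ∀ z → Z z ≡ true → Reaches vs z u

    initial : Family 0
    initial = record
      { vs = [] ; short = z≤n ; good = λ _ → true
      ; many = ≤-trans (≤-reflexive (cong (4 *_) (sum-replicate-zero n))) z≤n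
      ; R = λ x u → u == x
      ; size = λ x _ → ≤-reflexive (sym (trans (+-identityʳ _) (sum-χ-== x)))
      ; reachable = λ x u _ p → ε , Box-ε , ≈-trans (reflexive (cong pt (==⇒≡ u x p))) (≈-sym (identityʳ (pt x))) }

    -- Progress of one starting vertex within an epoch: the good vertices found so far. `φ` counts
    -- those still missing.
    data Status : Set where
      s0 : Status
      s1 : Fin n → Status
      s2 : Fin n → Fin n → Status

    φ : Status → ℕ
    φ s0       = 2
    φ (s1 _)   = 1
    φ (s2 _ _) = 0

    isOpen : Status → Bool
    isOpen (s2 _ _) = false
    isOpen _        = true

    module Epoch {k : ℕ} (F : Family k)
                 (no-hub : ∀ u → 16 * count (λ b → Family.good F b ∧ Family.R F b u) ≤ n) where
      open Family F renaming (reachable to reachF)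

      -- Half of the first set suffices: the union then has at least |R b|/2 + |R b′| elements,
      -- which gives the factor 3/2.
      small : Fin n → Fin n → Bool
      small b b′ = 2 * count (λ u → R b u ∧ R b′ u) ≤ᵇ count (R b)

      step : Maybe (Fin n) → Status → Status
      step nothing  st        = st
      step (just b) s0        = if good b then s1 b else s0
      step (just b) (s1 b₁)   = if good b ∧ small b₁ b then s2 b₁ b else s1 b₁
      step (just b) (s2 b₁ b₂) = s2 b₁ b₂

      next : ∀ {x} → Maybe (Live K x) → Fin N → Status → Status
      next nothing  v st = st
      next (just lv) v st = step (Live.τ lv v) st

      weight : ∀ {x} → Maybe (Live K x) → Status → ℕ
      weight m st = maybe′ (λ _ → φ st) 0 m

      unfinished : ∀ {x} → Maybe (Live K x) → Status → Bool
      unfinished m st = maybe′ (λ _ → isOpen st) false m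

      Valid : List (Fin N) → Fin n → Status → Set (c ⊔ ℓ)
      Valid ws x s0         = ⊤
      Valid ws x (s1 b)     = good b ≡ true × (∀ u → R b u ≡ true → Reaches ws x u)
      Valid ws x (s2 b₁ b₂) = good b₁ ≡ true × good b₂ ≡ true × small b₁ b₂ ≡ true ×
                              (∀ u → R b₁ u ≡ true → Reaches ws x u) × (∀ u → R b₂ u ≡ true → Reaches ws x u)

      skip : ∀ {ws x u} v → Reaches ws x u → Reaches (v ∷ ws) x u
      skip v (e , be , eq) = e , Box-skip v be , eq

      Valid-skip : ∀ {ws x} v st → Valid ws x st → Valid (v ∷ ws) x st
      Valid-skip v s0         _                   = tt
      Valid-skip v (s1 b)     (p , r)             = p , λ u q → skip v (r u q)
      Valid-skip v (s2 b₁ b₂) (p , q , s , r , t) = p , q , s , (λ u h → skip v (r u h)) , (λ u h → skip v (t u h))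

      _⊑_ : List (Fin N) → List (Fin N) → Set (c ⊔ ℓ)
      vs₁ ⊑ vs₂ = ∀ x u → Reaches vs₁ x u → Reaches vs₂ x u

      -- The new colour `v` leads from the cluster of `x` to some b, and from there the path
      -- continues as in the old family. That part involves only the old `vs`, so it skips whatever
      -- else the epoch has added.
      Valid-next : ∀ {ws x} → vs ⊑ ws → (m : Maybe (Live K x)) → ∀ v st → Valid ws x st → Valid (v ∷ ws) x (next m v st)
      Valid-next vs⊑ws nothing v st V = Valid-skip v st V
      Valid-next {ws} {x} vs⊑ws (just lv) v st V = go (Live.τ lv v) refl st V
        where
        through : ∀ b → Live.τ lv v ≡ just b → good b ≡ true → ∀ u → R b u ≡ true → Reaches (v ∷ ws) x u
        through b τv gb u Rbu with Cluster.reach (Live.cluster lv) v b τv | vs⊑ws b u (reachF b u gb Rbu)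
        ... | w , ww , b≈ | e , be , u≈ = (w ∙ g v) ∙ e , Box-step v ww be ,
              ≈-trans u≈ (≈-trans (∙-congʳ (≈-trans b≈ (assoc _ _ _))) (assoc _ _ _))
        go : ∀ m → Live.τ lv v ≡ m → ∀ st → Valid ws x st → Valid (v ∷ ws) x (step m st)
        go nothing  _  st         V = Valid-skip v st V
        go (just b) τv s0         V with good b in gb
        ... | true  = gb , through b τv gb
        ... | false = tt
        go (just b) τv (s1 b₁)    V with good b in gb | small b₁ b in sb
        ... | true  | true  = proj₁ V , gb , sb , (λ u q → skip v (proj₂ V u q)) , through b τv gb
        ... | true  | false = Valid-skip v (s1 b₁) V
        ... | false | _     = Valid-skip v (s1 b₁) V
        go (just b) τv (s2 b₁ b₂) V = Valid-skip v (s2 b₁ b₂) V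

      -- Since τ spreads evenly over the vertices, few of its values fall into a small exceptional set.
      landings : ∀ {x} (lv : Live K x) (Q : Fin n → Bool) → 8 * count (not ∘ Q) ≤ 3 * n →
                 N ≤ 32 * count (λ v → hits Q (Live.τ lv v))
      landings lv Q h = begin
        N                ≤⟨ saturated ⟩
        16 * D           ≤⟨ *-monoʳ-≤ 16 (*-cancelˡ-≤ {D} {2 * H} 4 4D≤) ⟩
        16 * (2 * H)     ≡⟨ *-assoc 16 2 H ⟨
        32 * H           ∎
        where
        open ≤-Reasoning
        open Live lv
        D = count (defined ∘ τ)
        H = count (λ v → hits Q (τ v))
        D≤ : D ≤ H + j * count (not ∘ Q)
        D≤ = ≤-trans (count≤+ (defined ∘ τ) (λ v → hits Q (τ v)) (λ v → hits (not ∘ Q) (τ v)) (λ v → split (τ v)))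
               (+-monoʳ-≤ H (count-fibres τ (not ∘ Q) j (fibres cluster)))
          where
          split : ∀ m → defined m ≡ true → hits Q m ≡ true ⊎ hits (not ∘ Q) m ≡ true
          split (just b) _ with Q b
          ... | true  = inj₁ refl
          ... | false = inj₂ refl
        -- At most 3nj/8 colours land outside `Q`, which is half of the lower bound 3nj/4 for the
        -- domain; the other half lands inside.
        4D≤ : 4 * D ≤ 4 * (2 * H)
        4D≤ = +-cancelʳ-≤ (4 * D) _ _ (begin
          4 * D + 4 * D                          ≡⟨ r₁ D ⟩
          8 * D                                  ≤⟨ *-monoʳ-≤ 8 D≤ ⟩
          8 * (H + j * count (not ∘ Q))          ≡⟨ r₂ H j (count (not ∘ Q)) ⟩
          4 * (2 * H) + j * (8 * count (not ∘ Q)) ≤⟨ +-monoʳ-≤ (4 * (2 * H)) (*-monoʳ-≤ j h) ⟩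
          4 * (2 * H) + j * (3 * n)              ≡⟨ cong (4 * (2 * H) +_) (*-comm j (3 * n)) ⟩
          4 * (2 * H) + 3 * n * j                ≤⟨ +-monoʳ-≤ (4 * (2 * H)) (Cluster.large cluster) ⟩
          4 * (2 * H) + 4 * D                    ∎)
          where
          r₁ : ∀ d → 4 * d + 4 * d ≡ 8 * d
          r₁ = solve-∀
          r₂ : ∀ h j q → 8 * (h + j * q) ≡ 4 * (2 * h) + j * (8 * q)
          r₂ = solve-∀

      bad-small : 8 * count (not ∘ good) ≤ 2 * n
      bad-small = ≤-trans (≤-reflexive (*-assoc 2 4 (count (not ∘ good)))) (*-monoʳ-≤ 2 many)

      overlapping : Fin n → Fin n → Bool
      overlapping b₁ b = good b ∧ not (small b₁ b)

      -- Double counting of the pairs (b , u) with u in R b₁ ∩ R b: every overlapping b contributes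
      -- more than |R b₁|/2 of them, while without a hub each u in R b₁ lies in at most n/16 pairs.
      few-overlapping : ∀ b₁ → good b₁ ≡ true → 8 * count (overlapping b₁) ≤ n
      few-overlapping b₁ g₁ = *-cancelʳ-≤ _ n (count (R b₁)) {{r≢0}} (begin
        8 * count (overlapping b₁) * r
          ≡⟨ *-assoc 8 (count (overlapping b₁)) r ⟩
        8 * (count (overlapping b₁) * r)
          ≡⟨ cong (8 *_) (trans (*-comm (count (overlapping b₁)) r) (*-distribˡ-sum r (χ ∘ overlapping b₁))) ⟩
        8 * sum (λ b → r * χ (overlapping b₁ b))
          ≤⟨ *-monoʳ-≤ 8 (sum-mono pointwise) ⟩
        8 * sum (λ b → 2 * sum (λ u → χ (R b₁ u) * χ (good b ∧ R b u)))
          ≡⟨ cong (8 *_) (*-distribˡ-sum 2 (λ b → sum (λ u → χ (R b₁ u) * χ (good b ∧ R b u)))) ⟨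
        8 * (2 * sum (λ b → sum (λ u → χ (R b₁ u) * χ (good b ∧ R b u))))
          ≡⟨ *-assoc 8 2 (sum (λ b → sum (λ u → χ (R b₁ u) * χ (good b ∧ R b u)))) ⟨
        16 * sum (λ b → sum (λ u → χ (R b₁ u) * χ (good b ∧ R b u)))
          ≡⟨ cong (16 *_) (∑-comm (λ b u → χ (R b₁ u) * χ (good b ∧ R b u))) ⟩
        16 * sum (λ u → sum (λ b → χ (R b₁ u) * χ (good b ∧ R b u)))
          ≡⟨ cong (16 *_) (sum-cong-≗ (λ u → sym (*-distribˡ-sum (χ (R b₁ u)) (λ b → χ (good b ∧ R b u))))) ⟩
        16 * sum (λ u → χ (R b₁ u) * indeg u)
          ≡⟨ *-distribˡ-sum 16 (λ u → χ (R b₁ u) * indeg u) ⟩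
        sum (λ u → 16 * (χ (R b₁ u) * indeg u))
          ≤⟨ sum-mono (λ u → ≤-trans (≤-reflexive (r₁ (χ (R b₁ u)) (indeg u))) (*-monoˡ-≤ (χ (R b₁ u)) (no-hub u))) ⟩
        sum (λ u → n * χ (R b₁ u))
          ≡⟨ *-distribˡ-sum n (χ ∘ R b₁) ⟨
        n * r ∎)
        where
        open ≤-Reasoning
        r = count (R b₁)
        indeg : Fin n → ℕ
        indeg u = count (λ b → good b ∧ R b u)
        r₁ : ∀ a b → 16 * (a * b) ≡ 16 * b * a
        r₁ = solve-∀
        r≢0 : NonZero r
        r≢0 = ≢-nonZero λ r≡0 → n≮0 (≤-trans (m^n>0 3 k) (≤-trans (size b₁ g₁) (≤-reflexive (trans (cong (2 ^ k *_) r≡0) (*-zeroʳ (2 ^ k))))))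
        χ-∧ : ∀ a b c → c ≡ true → χ (a ∧ b) ≡ χ a * χ (c ∧ b)
        χ-∧ true  b c refl = sym (+-identityʳ (χ b))
        χ-∧ false b c refl = refl
        pointwise : ∀ b → r * χ (overlapping b₁ b) ≤ 2 * sum (λ u → χ (R b₁ u) * χ (good b ∧ R b u))
        pointwise b with good b in gb | small b₁ b in sb
        ... | false | _     = ≤-trans (≤-reflexive (*-zeroʳ r)) z≤n
        ... | true  | true  = ≤-trans (≤-reflexive (*-zeroʳ r)) z≤n
        ... | true  | false = ≤-trans (≤-reflexive (*-identityʳ r)) (≤-trans (<⇒≤ (≤ᵇ-false _ _ sb))
                (≤-reflexive (cong (2 *_) (sum-cong-≗ (λ u → χ-∧ (R b₁ u) (R b u) true refl)))))

      -- For an unfinished live vertex, at least N/32 colours find a further good vertex and lower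
      -- `φ` by one. The exceptions number at most n/4 for `good` and n/8 for `small`, together the
      -- 3n/8 that `landings` tolerates.
      drift : ∀ {ws x} (m : Maybe (Live K x)) st → Valid ws x st →
              32 * sum (λ v → weight m (next m v st)) + N * χ (unfinished m st) ≤ 32 * (N * weight m st)
      drift nothing st V = ≤-reflexive (trans (cong₂ (λ a b → 32 * a + b) (sum-replicate-zero N) (*-zeroʳ N)) (sym (cong (32 *_) (*-zeroʳ N))))
      drift (just lv) (s2 b₁ b₂) V = ≤-reflexive (trans (cong₂ (λ a b → 32 * a + b) (trans (sum-cong-≗ (λ v → still (Live.τ lv v))) (sum-replicate-zero N)) (*-zeroʳ N)) (sym (cong (32 *_) (*-zeroʳ N))))
        where
        still : ∀ m → φ (step m (s2 b₁ b₂)) ≡ 0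
        still nothing  = refl
        still (just b) = refl
      drift (just lv) s0 V = begin
        32 * S + N * 1              ≡⟨ cong (32 * S +_) (*-identityʳ N) ⟩
        32 * S + N                  ≤⟨ +-monoʳ-≤ (32 * S) (landings lv good (≤-trans bad-small (*-monoˡ-≤ n (n≤1+n 2)))) ⟩
        32 * S + 32 * H             ≡⟨ *-distribˡ-+ 32 S H ⟨
        32 * (S + H)                ≡⟨ cong (32 *_) (trans (sym (∑-distrib-+ (λ v → φ (step (τ v) s0)) (λ v → χ (hits good (τ v))))) (trans (sum-cong-≗ (λ v → exact (τ v))) (sum-const N 2))) ⟩
        32 * (N * 2)                ∎
        where
        open ≤-Reasoning
        open Live lv using (τ)
        S = sum (λ v → φ (step (τ v) s0))
        H = count (λ v → hits good (τ v))
        exact : ∀ m → φ (step m s0) + χ (hits good m) ≡ 2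
        exact nothing = refl
        exact (just b) with good b
        ... | true  = refl
        ... | false = refl
      drift (just lv) (s1 b₁) V = begin
        32 * S + N * 1              ≡⟨ cong (32 * S +_) (*-identityʳ N) ⟩
        32 * S + N                  ≤⟨ +-monoʳ-≤ (32 * S) (landings lv Q few) ⟩
        32 * S + 32 * H             ≡⟨ *-distribˡ-+ 32 S H ⟨
        32 * (S + H)                ≡⟨ cong (32 *_) (trans (sym (∑-distrib-+ (λ v → φ (step (τ v) (s1 b₁))) (λ v → χ (hits Q (τ v))))) (trans (sum-cong-≗ (λ v → exact (τ v))) (sum-const N 1))) ⟩
        32 * (N * 1)                ∎
        where
        open ≤-Reasoning
        open Live lv using (τ)
        Q : Fin n → Bool
        Q b = good b ∧ small b₁ b
        S = sum (λ v → φ (step (τ v) (s1 b₁)))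
        H = count (λ v → hits Q (τ v))
        exact : ∀ m → φ (step m (s1 b₁)) + χ (hits Q m) ≡ 1
        exact nothing = refl
        exact (just b) with good b ∧ small b₁ b
        ... | true  = refl
        ... | false = refl
        few : 8 * count (not ∘ Q) ≤ 3 * n
        few = begin
          8 * count (not ∘ Q)                                        ≤⟨ *-monoʳ-≤ 8 (count≤+ (not ∘ Q) (not ∘ good) (overlapping b₁) (λ b → split (good b) (small b₁ b))) ⟩
          8 * (count (not ∘ good) + count (overlapping b₁))          ≡⟨ *-distribˡ-+ 8 (count (not ∘ good)) (count (overlapping b₁)) ⟩
          8 * count (not ∘ good) + 8 * count (overlapping b₁)        ≤⟨ +-mono-≤ bad-small (few-overlapping b₁ (proj₁ V)) ⟩
          2 * n + n                                                  ≡⟨ +-comm (2 * n) n ⟩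
          3 * n                                                      ∎
          where
          split : ∀ a b → not (a ∧ b) ≡ true → not a ≡ true ⊎ (a ∧ not b) ≡ true
          split true  b p = inj₂ p
          split false b p = inj₁ refl

      potential : (Fin n → Status) → ℕ
      potential σ = sum (λ x → weight (live? x) (σ x))

      pending : (Fin n → Status) → ℕ
      pending σ = count (λ x → unfinished (live? x) (σ x))

      advance : (Fin n → Status) → Fin N → Fin n → Status
      advance σ v x = next (live? x) v (σ x)

      total-drift : ∀ {ws} σ → (∀ x → Valid ws x (σ x)) →
                    32 * sum (λ v → potential (advance σ v)) + N * pending σ ≤ 32 * (N * potential σ)
      total-drift σ V = begin
        32 * sum (λ v → potential (advance σ v)) + N * pending σ
          ≡⟨ cong₂ (λ a b → 32 * a + b) (∑-comm (λ v x → weight (live? x) (advance σ v x))) (*-distribˡ-sum N (λ x → χ (unfinished (live? x) (σ x)))) ⟩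
        32 * sum (λ x → sum (λ v → weight (live? x) (advance σ v x))) + sum (λ x → N * χ (unfinished (live? x) (σ x)))
          ≡⟨ cong (_+ sum (λ x → N * χ (unfinished (live? x) (σ x)))) (*-distribˡ-sum 32 (λ x → sum (λ v → weight (live? x) (advance σ v x)))) ⟩
        sum (λ x → 32 * sum (λ v → weight (live? x) (advance σ v x))) + sum (λ x → N * χ (unfinished (live? x) (σ x)))
          ≡⟨ ∑-distrib-+ (λ x → 32 * sum (λ v → weight (live? x) (advance σ v x))) (λ x → N * χ (unfinished (live? x) (σ x))) ⟨
        sum (λ x → 32 * sum (λ v → weight (live? x) (advance σ v x)) + N * χ (unfinished (live? x) (σ x)))
          ≤⟨ sum-mono (λ x → drift (live? x) (σ x) (V x)) ⟩
        sum (λ x → 32 * (N * weight (live? x) (σ x)))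
          ≡⟨ trans (cong (32 *_) (*-distribˡ-sum N (λ x → weight (live? x) (σ x)))) (*-distribˡ-sum 32 (λ x → N * weight (live? x) (σ x))) ⟨
        32 * (N * potential σ) ∎
        where open ≤-Reasoning

      colour-exists : 0 < N
      colour-exists with count-witness {n} (λ _ → true) (subst (0 <_) (sym (count-full (λ _ → true) (λ _ → refl))) n>0)
      ... | x , _ = ≤-trans (s≤s z≤n) (inhabited (col x x))
        where
        inhabited : ∀ {m} → Fin m → 0 < m
        inhabited zero    = z<s
        inhabited (suc _) = z<s

      -- Each of more than n/8 unfinished vertices loses at least 1/32 on average over all colours,
      -- so some colour lowers the potential by n/256.
      good-colour : ∀ {ws} σ → (∀ x → Valid ws x (σ x)) → n < 8 * pending σ →
                    ∃ λ v → 256 * potential (advance σ v) + n ≤ 256 * potential σ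
      good-colour σ V n<8p = averageN colour-exists (λ v → 256 * potential (advance σ v) + n) (256 * potential σ) (begin
          sum (λ v → 256 * potential (advance σ v) + n)
            ≡⟨ ∑-distrib-+ (λ v → 256 * potential (advance σ v)) (λ _ → n) ⟩
          sum (λ v → 256 * potential (advance σ v)) + sum {N} (λ _ → n)
            ≡⟨ cong₂ _+_ (sym (*-distribˡ-sum 256 (λ v → potential (advance σ v)))) (sum-const N n) ⟩
          256 * S + N * n
            ≤⟨ +-monoʳ-≤ (256 * S) (*-monoʳ-≤ N (<⇒≤ n<8p)) ⟩
          256 * S + N * (8 * pending σ)
            ≡⟨ r₁ S N (pending σ) ⟩
          8 * (32 * S + N * pending σ)
            ≤⟨ *-monoʳ-≤ 8 (total-drift σ V) ⟩
          8 * (32 * (N * potential σ))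
            ≡⟨ r₂ N (potential σ) ⟩
          N * (256 * potential σ) ∎)
        where
        open ≤-Reasoning
        S = sum (λ v → potential (advance σ v))
        r₁ : ∀ s N p → 256 * s + N * (8 * p) ≡ 8 * (32 * s + N * p)
        r₁ = solve-∀
        r₂ : ∀ N p → 8 * (32 * (N * p)) ≡ N * (256 * p)
        r₂ = solve-∀
        averageN : ∀ {m} → 0 < m → (f : Fin m → ℕ) (c : ℕ) → sum f ≤ m * c → ∃ λ i → f i ≤ c
        averageN {suc m} _ = average

      record Finished (s : ℕ) (ws : List (Fin N)) : Set (c ⊔ ℓ) where
        field
          ws′   : List (Fin N)
          len   : length ws′ ≤ length ws + s
          σ     : Fin n → Status
          valid : ∀ x → Valid ws′ x (σ x)
          done  : 8 * pending σ ≤ n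

      run : ∀ s ws σ → vs ⊑ ws → (∀ x → Valid ws x (σ x)) → 256 * potential σ ≤ n * s → Finished s ws
      run s ws σ ⊑ws V budget = go (8 * pending σ ≤? n)
        where
        continue : ∀ s → 256 * potential σ ≤ n * s →
                   (∃ λ v → 256 * potential (advance σ v) + n ≤ 256 * potential σ) → Finished s ws
        continue zero    budget (v , dec) =
          ⊥-elim (n≮0 (≤-trans n>0 (≤-trans (m≤n+m n (256 * potential (advance σ v))) (≤-trans dec (≤-trans budget (≤-reflexive (*-zeroʳ n)))))))
        continue (suc s) budget (v , dec) =
          record { ws′ = Finished.ws′ rec ; len = ≤-trans (Finished.len rec) (≤-reflexive (sym (+-suc (length ws) s)))
                 ; σ = Finished.σ rec ; valid = Finished.valid rec ; done = Finished.done rec }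
          where
          rec : Finished s (v ∷ ws)
          rec = run s (v ∷ ws) (advance σ v) (λ x u r → skip v (⊑ws x u r)) (λ x → Valid-next ⊑ws (live? x) v (σ x) (V x))
            (+-cancelˡ-≤ n _ _ (≤-trans (≤-reflexive (+-comm n (256 * potential (advance σ v)))) (≤-trans dec (≤-trans budget (≤-reflexive (*-suc n s))))))
        go : Dec (8 * pending σ ≤ n) → Finished s ws
        go (yes done)  = record { ws′ = ws ; len = m≤m+n (length ws) s ; σ = σ ; valid = V ; done = done }
        go (no  ¬done) = continue s budget (good-colour σ V (≰⇒> ¬done))

      conclude : Finished 512 vs → Family (suc k)
      conclude done-run = record
        { vs    = ws′
        ; short = ≤-trans len (≤-trans (+-monoˡ-≤ 512 short) (≤-reflexive (trans (+-comm (512 * k) 512) (sym (*-suc 512 k)))))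
        ; good  = λ x → finished (live? x) (σ x)
        -- Vertices without a live cluster and unfinished ones: at most n/8 each.
        ; many  = *-cancelˡ-≤ 2 (begin
            2 * (4 * count (λ x → not (finished (live? x) (σ x))))  ≡⟨ *-assoc 2 4 (count (λ x → not (finished (live? x) (σ x)))) ⟨
            8 * count (λ x → not (finished (live? x) (σ x)))        ≤⟨ *-monoʳ-≤ 8 (count≤+ (λ x → not (finished (live? x) (σ x))) (λ x → not (maybe′ (λ _ → true) false (live? x))) (λ x → unfinished (live? x) (σ x)) (λ x → split (live? x) (σ x))) ⟩
            8 * (dead + pending σ)                                  ≡⟨ *-distribˡ-+ 8 dead (pending σ) ⟩
            8 * dead + 8 * pending σ                                ≤⟨ +-mono-≤ mostlyLive done ⟩
            n + n                                                   ≡⟨ cong (n +_) (sym (+-identityʳ n)) ⟩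
            2 * n                                                   ∎)
        ; R     = λ x → union (σ x)
        ; size  = λ x gx → size′ x (live? x) (σ x) gx (valid x)
        ; reachable = λ x u gx Ru → reach′ x (live? x) u (σ x) gx Ru (valid x) }
        where
        open ≤-Reasoning
        open Finished done-run
        dead = count (λ x → not (maybe′ (λ _ → true) false (live? x)))
        finished : ∀ {x} → Maybe (Live K x) → Status → Bool
        finished nothing  _  = false
        finished (just _) st = not (isOpen st)
        split : ∀ {x} (m : Maybe (Live K x)) st → not (finished m st) ≡ true →
                not (maybe′ (λ _ → true) false m) ≡ true ⊎ unfinished m st ≡ true
        split nothing  st         _ = inj₁ refl
        split (just _) s0         _ = inj₂ refl
        split (just _) (s1 _)     _ = inj₂ refl
        split (just _) (s2 _ _)   ()
        union : Status → Fin n → Bool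
        union (s2 b₁ b₂) u = R b₁ u ∨ R b₂ u
        union _          u = false
        size′ : ∀ x (m : Maybe (Live K x)) st → finished m st ≡ true → Valid ws′ x st → 3 ^ suc k ≤ 2 ^ suc k * count (union st)
        size′ x (just _) (s2 b₁ b₂) _ (g₁ , g₂ , sm , _ , _) = begin
          3 * 3 ^ k                                 ≤⟨ +-mono-≤ (size b₁ g₁) (*-monoʳ-≤ 2 (size b₂ g₂)) ⟩
          2 ^ k * A + 2 * (2 ^ k * B)               ≡⟨ r₁ (2 ^ k) A B ⟩
          2 ^ k * (A + 2 * B)                       ≤⟨ *-monoʳ-≤ (2 ^ k) A+2B≤ ⟩
          2 ^ k * (2 * U)                           ≡⟨ r₂ (2 ^ k) U ⟩
          2 * 2 ^ k * U                             ∎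
          where
          A = count (R b₁)
          B = count (R b₂)
          I = count (λ u → R b₁ u ∧ R b₂ u)
          U = count (λ u → R b₁ u ∨ R b₂ u)
          r₁ : ∀ p a b → p * a + 2 * (p * b) ≡ p * (a + 2 * b)
          r₁ = solve-∀
          r₂ : ∀ p u → p * (2 * u) ≡ 2 * p * u
          r₂ = solve-∀
          incl-excl : A + B ≡ U + I
          incl-excl = trans (sym (∑-distrib-+ (χ ∘ R b₁) (χ ∘ R b₂)))
                        (trans (sum-cong-≗ (λ u → χ-∨-∧ (R b₁ u) (R b₂ u)))
                          (∑-distrib-+ (λ u → χ (R b₁ u ∨ R b₂ u)) (λ u → χ (R b₁ u ∧ R b₂ u))))
            where
            χ-∨-∧ : ∀ a b → χ a + χ b ≡ χ (a ∨ b) + χ (a ∧ b)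
            χ-∨-∧ true  true  = refl
            χ-∨-∧ true  false = refl
            χ-∨-∧ false b     = sym (+-identityʳ (χ b))
          A+2B≤ : A + 2 * B ≤ 2 * U
          A+2B≤ = +-cancelˡ-≤ A _ _ (begin
            A + (A + 2 * B)      ≡⟨ r₃ A B ⟩
            2 * (A + B)          ≡⟨ cong (2 *_) incl-excl ⟩
            2 * (U + I)          ≡⟨ *-distribˡ-+ 2 U I ⟩
            2 * U + 2 * I        ≤⟨ +-monoʳ-≤ (2 * U) (≤ᵇ-true _ _ sm) ⟩
            2 * U + A            ≡⟨ +-comm (2 * U) A ⟩
            A + 2 * U            ∎)
            where
            r₃ : ∀ a b → a + (a + 2 * b) ≡ 2 * (a + b)
            r₃ = solve-∀
        reach′ : ∀ x (m : Maybe (Live K x)) u st → finished m st ≡ true → union st u ≡ true → Valid ws′ x st → Reaches ws′ x u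
        reach′ x (just _) u (s2 b₁ b₂) _ Ru (_ , _ , _ , r₁ , r₂) with ∨-elim {R b₁ u} Ru
        ... | inj₁ p = r₁ u p
        ... | inj₂ p = r₂ u p

      epoch : Family (suc k)
      -- The potential starts at no more than 2n and drops by n/256 per colour, hence 512 colours.
      epoch = conclude (run 512 vs (λ _ → s0) (λ _ _ r → r) (λ _ → tt) (begin
          256 * potential (λ _ → s0)     ≤⟨ *-monoʳ-≤ 256 (sum-mono (λ x → ≤2 (live? x))) ⟩
          256 * sum {n} (λ _ → 2)        ≡⟨ cong (256 *_) (sum-const n 2) ⟩
          256 * (n * 2)                  ≡⟨ r n ⟩
          n * 512                        ∎))
        where
        open ≤-Reasoning
        ≤2 : ∀ {x} (m : Maybe (Live K x)) → weight m s0 ≤ 2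
        ≤2 (just _) = ≤-refl
        ≤2 nothing  = z≤n
        r : ∀ n → 256 * (n * 2) ≡ n * 512
        r = solve-∀

    advance-epoch : ∀ {k} → Family k → Hub k ⊎ Family (suc k)
    advance-epoch {k} F with find (λ u → n ≤ᵇ 16 * count (λ b → good b ∧ R b u))
      where open Family F
    ... | inj₁ (u , p) = inj₁ (record
            { vs = vs ; short = short ; u = u ; Z = λ b → good b ∧ R b u ; dense = ≤ᵇ-true n _ p
            ; reachable = λ z q → reachable z u (proj₁ (∧-elim q)) (proj₂ (∧-elim {good z} q)) })
      where open Family F
    ... | inj₂ none = inj₂ (Epoch.epoch F (λ u → <⇒≤ (≤ᵇ-false n _ (none u))))

    Hub-mono : ∀ {k k′} → k ≤ k′ → Hub k → Hub k′
    Hub-mono k≤k′ H = record { vs = vs ; short = ≤-trans short (*-monoʳ-≤ 512 k≤k′) ; u = u ; Z = Z ; dense = dense ; reachable = reachable }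
      where open Hub H

    iterate : ∀ k → Hub k ⊎ Family k
    iterate zero    = inj₂ initial
    iterate (suc k) with iterate k
    ... | inj₁ H = inj₁ (Hub-mono (n≤1+n k) H)
    ... | inj₂ F with advance-epoch F
    ...   | inj₁ H  = inj₁ (Hub-mono (n≤1+n k) H)
    ...   | inj₂ F′ = inj₂ F′

    -- Without a hub up to stage `k`, a good vertex would reach at least (3/2)^k > n vertices.
    hub : ∀ k → n * 2 ^ k < 3 ^ k → Hub k
    hub k n2ᵏ<3ᵏ with iterate k
    ... | inj₁ H = H
    ... | inj₂ F = ⊥-elim (<-irrefl refl (begin-strict
        n * 2 ^ k               <⟨ n2ᵏ<3ᵏ ⟩
        3 ^ k                   ≤⟨ size x gx ⟩
        2 ^ k * count (R x)     ≤⟨ *-monoʳ-≤ (2 ^ k) (count≤ (R x)) ⟩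
        2 ^ k * n               ≡⟨ *-comm (2 ^ k) n ⟩
        n * 2 ^ k               ∎))
      where
      open ≤-Reasoning
      open Family F
      some-good : 0 < count good
      some-good with count good in eq
      ... | suc _ = z<s
      ... | zero  = ⊥-elim (<-irrefl refl (begin-strict
          n                              <⟨ m<m+n n n>0 ⟩
          n + n                          ≤⟨ +-monoʳ-≤ n (m≤m+n n _) ⟩
          4 * n                          ≡⟨ cong (4 *_) (trans (sym (count-not good)) (cong (_+ count (not ∘ good)) eq)) ⟩
          4 * count (not ∘ good)         ≤⟨ many ⟩
          n                              ∎))
      x = proj₁ (count-witness good some-good)
      gx = proj₂ (count-witness good some-good)

  -- Ruzsa covering in terms of colours

  module Covering (Z : Fin n → Bool) (Z≠∅ : 0 < count Z) where

    -- Equal colours have equal differences: a - z = y - z′, a common point of the translates a - Z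
    -- and y - Z.
    Meets : Fin n → Fin n → Set
    Meets a y = ∃ λ z → ∃ λ z′ → Z z ≡ true × Z z′ ≡ true × col z a ≡ col z′ y

    -- A greedy maximal choice of centres with disjoint colour sets {col z y : z ∈ Z}. Each set has
    -- |Z| elements because the colour and the end point determine z, and all of them fit into N
    -- colours.
    record Packing (as : List (Fin n)) : Set where
      field
        Ys       : List (Fin n)
        used     : Fin N → Bool
        disjoint : length Ys * count Z ≤ count used
        used⁻    : ∀ v → used v ≡ true → ∃ λ y → y ∈ₗ Ys × ∃ λ z → Z z ≡ true × col z y ≡ v
        covers   : ∀ {a} → a ∈ₗ as → ∃ λ y → y ∈ₗ Ys × Meets a y

    extend : ∀ {as} a → Packing as → Packing (a ∷ as)
    extend {as} a P = go (find (λ z → Z z ∧ used (col z a)))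
      where
      open Packing P
      go : (∃ λ z → (Z z ∧ used (col z a)) ≡ true) ⊎ (∀ z → (Z z ∧ used (col z a)) ≡ false) → Packing (a ∷ as)
      go (inj₁ (z , p)) = record
        { Ys = Ys ; used = used ; disjoint = disjoint ; used⁻ = used⁻
        ; covers = λ { (here refl) → let y , y∈ , z′ , Zz′ , eq = used⁻ (col z a) (proj₂ (∧-elim {Z z} p))
                                     in y , y∈ , z , z′ , proj₁ (∧-elim p) , Zz′ , sym eq
                     ; (there a∈) → covers a∈ } }
      go (inj₂ none) = record
        { Ys = a ∷ Ys ; used = λ v → used v ∨ hit v
        ; disjoint = ≤-trans (≤-reflexive (+-comm (count Z) (length Ys * count Z))) (≤-trans (+-monoˡ-≤ (count Z) disjoint) grow)
        ; used⁻ = used⁻′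
        ; covers = λ { (here refl) → let z , Zz = count-witness Z Z≠∅ in a , here refl , z , z , Zz , Zz , refl
                     ; (there a∈)  → let y , y∈ , m = covers a∈ in y , there y∈ , m } }
        where
        search : ∀ v → (∃ λ z → (Z z ∧ (v == col z a)) ≡ true) ⊎ (∀ z → (Z z ∧ (v == col z a)) ≡ false)
        search v = find (λ z → Z z ∧ (v == col z a))
        hit : Fin N → Bool
        hit v with search v
        ... | inj₁ _ = true
        ... | inj₂ _ = false
        used⁻′ : ∀ v → (used v ∨ hit v) ≡ true → ∃ λ y → y ∈ₗ (a ∷ Ys) × ∃ λ z → Z z ≡ true × col z y ≡ v
        used⁻′ v p with used v in uv | search v
        ... | true  | _ = let y , y∈ , rest = used⁻ v uv in y , there y∈ , rest
        ... | false | inj₁ (z , q) = a , here refl , z , proj₁ (∧-elim q) , sym (==⇒≡ v (col z a) (proj₂ (∧-elim {Z z} q)))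
        used⁻′ v () | false | inj₂ _
        pointwise : ∀ v → χ (used v) + sum (λ z → χ (Z z) * χ (v == col z a)) ≤ χ (used v ∨ hit v)
        pointwise v with used v in uv | search v
        ... | true  | _ = ≤-reflexive (cong suc (sum-≗0 (λ z → vanish z (Z z) refl (v == col z a) refl)))
          where
          vanish : ∀ z b → Z z ≡ b → ∀ d → (v == col z a) ≡ d → χ b * χ d ≡ 0
          vanish z false _  d     _  = refl
          vanish z true  _  false _  = refl
          vanish z true  Zz true  vd = true≢false uv (trans (cong used (==⇒≡ v _ vd))
            (trans (cong (_∧ used (col z a)) (sym Zz)) (none z)))
        ... | false | inj₁ (z , q) = ≤-trans (≤-reflexive (sum-cong-≗ (λ z → sym (χ-∧ (Z z) (v == col z a)))))
                (count-unique (λ z → Z z ∧ (v == col z a)) (λ z z′ p p′ →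
                  col-injˡ a (trans (sym (==⇒≡ v _ (proj₂ (∧-elim {Z z} p)))) (==⇒≡ v _ (proj₂ (∧-elim {Z z′} p′))))))
          where
          χ-∧ : ∀ a b → χ (a ∧ b) ≡ χ a * χ b
          χ-∧ true  b = sym (+-identityʳ (χ b))
          χ-∧ false b = refl
        ... | false | inj₂ empty = ≤-reflexive (sum-≗0 (λ z → vanish (Z z) (v == col z a) (empty z)))
          where
          vanish : ∀ b d → (b ∧ d) ≡ false → χ b * χ d ≡ 0
          vanish true  false _ = refl
          vanish false d     _ = refl
        grow : count used + count Z ≤ count (λ v → used v ∨ hit v)
        grow = begin
          count used + count Z
            ≡⟨ cong (count used +_) (sum-cong-≗ (λ z → sym (sum-δ (λ _ → χ (Z z)) (col z a)))) ⟩
          count used + sum (λ z → sum (λ v → χ (Z z) * χ (v == col z a)))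
            ≡⟨ cong (count used +_) (∑-comm (λ z v → χ (Z z) * χ (v == col z a))) ⟩
          count used + sum (λ v → sum (λ z → χ (Z z) * χ (v == col z a)))
            ≡⟨ ∑-distrib-+ (χ ∘ used) (λ v → sum (λ z → χ (Z z) * χ (v == col z a))) ⟨
          sum (λ v → χ (used v) + sum (λ z → χ (Z z) * χ (v == col z a)))
            ≤⟨ sum-mono pointwise ⟩
          count (λ v → used v ∨ hit v) ∎
          where open ≤-Reasoning

    packing : ∀ as → Packing as
    packing []       = record { Ys = [] ; used = λ _ → false ; disjoint = z≤n ; used⁻ = λ _ () ; covers = λ () }
    packing (a ∷ as) = extend a (packing as)

  -- Assembly of the spanning sequence

  module Conclusion (l : ℕ) (64L≤n : 64 * suc l ≤ n) (B : ℕ) (B>0 : 0 < B) (N≤BL : N ≤ B * suc l)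
                    (W : ℕ) (16N≤Wn : 16 * N ≤ W * n) (k : ℕ) (n2ᵏ<3ᵏ : n * 2 ^ k < 3 ^ k) where
    open Sampling l 64L≤n B B>0 N≤BL using (Kept; sample)

    -- The number `β` of digits stays open, since it is chosen afterwards from the bound on `J` or
    -- from the exponent.
    Spanned : Set (c ⊔ ℓ)
    Spanned = ∃ λ J → J ≤ 512 * k × (∀ β → Digits J β →
                ∃ λ S → length S ≤ W + 2 * B * β + J × (∀ x → InSpan G S (pt x)))

    n>0 : 0 < n
    n>0 = ≤-trans (s≤s z≤n) 64L≤n

    module _ (κ : Kept) where
      open Kept κ
      open Growth (lookup kept) n>0 live? mostlyLive

      module _ (H : Hub k) where
        open Hub H

        Z≠∅ : 0 < count Z
        Z≠∅ with count Z in eq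
        ... | suc _ = z<s
        ... | zero  = ⊥-elim (n≮0 (≤-trans n>0 (≤-trans dense (≤-reflexive (cong (16 *_) eq)))))

        open Covering Z Z≠∅

        subval-difference : ∀ vs bs bs′ → InSpan G (map g vs) (subval vs bs ∙ subval vs bs′ ⁻¹)
        subval-difference []       []       []         = InSpan-≈ [] (inverseʳ ε) (InSpan-ε [])
        subval-difference (v ∷ vs) (b ∷ bs) (b′ ∷ bs′) =
          InSpan-≈ (g v ∷ map g vs) (≈-trans (quotient-∙ _ _ _ _) (∙-congʳ (≈-sym (sign-≈ b b′))))
            (InSpan-∷ (map g vs) (sign b b′) (g v) (subval-difference vs bs bs′))
          where
          open AGProps G using (ε⁻¹≈ε)
          sign : Bool → Bool → Sign
          sign true  true  = zer
          sign true  false = Sign.pos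
          sign false true  = neg
          sign false false = zer
          sign-≈ : ∀ b b′ → signed G (sign b b′) (g v) ≈ (if b then g v else ε) ∙ (if b′ then g v else ε) ⁻¹
          sign-≈ true  true  = ≈-sym (inverseʳ (g v))
          sign-≈ true  false = ≈-sym (≈-trans (∙-congˡ ε⁻¹≈ε) (identityʳ (g v)))
          sign-≈ false true  = ≈-sym (identityˡ (g v ⁻¹))
          sign-≈ false false = ≈-sym (inverseʳ ε)

        translate : ∀ {a y e e′} → a ∙ e ≈ y ∙ e′ → a ≈ y ∙ (e′ ∙ e ⁻¹)
        translate {a} {y} {e} {e′} eq = ≈-trans (≈-sym (identityʳ a)) (≈-trans (∙-congˡ (≈-sym (inverseʳ e)))
          (≈-trans (≈-sym (assoc a e (e ⁻¹))) (≈-trans (∙-congʳ eq) (assoc y e′ (e ⁻¹)))))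

        swap : ∀ x y z → (x ∙ y) ∙ z ≈ (x ∙ z) ∙ y
        swap x y z = ≈-trans (assoc x y z) (≈-trans (∙-congˡ (comm y z)) (≈-sym (assoc x z y)))

        module _ (P : Packing (allFin n)) where
          open Packing P

          few-centres : length Ys ≤ W
          few-centres = *-cancelʳ-≤ (length Ys) W n {{>-nonZero n>0}} (begin
            length Ys * n                  ≤⟨ *-monoʳ-≤ (length Ys) dense ⟩
            length Ys * (16 * count Z)     ≡⟨ r (length Ys) (count Z) ⟩
            16 * (length Ys * count Z)     ≤⟨ *-monoʳ-≤ 16 (≤-trans disjoint (count≤ used)) ⟩
            16 * N                         ≤⟨ 16N≤Wn ⟩
            W * n                          ∎)
            where
            open ≤-Reasoning
            r : ∀ y z → y * (16 * z) ≡ 16 * (y * z)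
            r = solve-∀

          spanned : Spanned
          spanned = length vs , short , λ β dig → S β , len β , λ x → inSpan β dig x (covers (∈-allFin x))
            where
            S : ℕ → List X
            S β = map pt Ys ++ (digitsOf β g kept ++ map g vs)
            len : ∀ β → length (S β) ≤ W + 2 * B * β + length vs
            len β = begin
              length (S β)
                ≡⟨ trans (length-++ (map pt Ys)) (cong₂ _+_ (length-map pt Ys) (trans (length-++ (digitsOf β g kept))
                     (cong₂ _+_ (length-digitsOf β g kept) (length-map g vs)))) ⟩
              length Ys + (count (lookup kept) * β + length vs)
                ≡⟨ +-assoc (length Ys) (count (lookup kept) * β) (length vs) ⟨
              length Ys + count (lookup kept) * β + length vs
                ≤⟨ +-monoˡ-≤ (length vs) (+-mono-≤ few-centres (*-monoˡ-≤ β kept-few)) ⟩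
              W + 2 * B * β + length vs ∎
              where open ≤-Reasoning
            inSpan : ∀ β → Digits (length vs) β → ∀ x → (∃ λ y → y ∈ₗ Ys × Meets x y) → InSpan G (S β) (pt x)
            inSpan β dig x (y , y∈ , z , z′ , Zz , Zz′ , eq) =
              let e  , (a  , bs  , a≤  , e≈)  , u≈  = reachable z Zz
                  e′ , (a′ , bs′ , a′≤ , e′≈) , u≈′ = reachable z′ Zz′
                  h = g (col z x)
                  -- Both x + e and y + e′ equal u + h, where h is the difference that x - z and y -
                  -- z′ share. The hub cancels and x = y + (e′ - e) remains.
                  x≈ : pt x ∙ e ≈ pt u ∙ h
                  x≈ = ≈-trans (∙-congʳ (pt-col z x)) (≈-trans (swap (pt z) h e) (∙-congʳ (≈-sym u≈)))
                  y≈ : pt y ∙ e′ ≈ pt u ∙ h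
                  y≈ = ≈-trans (∙-congʳ (≈-trans (pt-col z′ y) (∙-congˡ (reflexive (cong g (sym eq))))))
                         (≈-trans (swap (pt z′) h e′) (∙-congʳ (≈-sym u≈′)))
              in InSpan-≈ (S β) (translate (≈-trans x≈ (≈-sym y≈)))
                   (InSpan-++ (map pt Ys) (digitsOf β g kept ++ map g vs) (InSpan-∈ (∈-map⁺ pt y∈))
                     (InSpan-≈ (digitsOf β g kept ++ map g vs)
                       (≈-trans (∙-cong e′≈ (⁻¹-cong e≈)) (quotient-∙ (value a′) (subval vs bs′) (value a) (subval vs bs)))
                       (InSpan-++ (digitsOf β g kept) (map g vs)
                         (InSpan-digitsOf (length vs) β dig g kept a′ a a′≤ a≤)
                         (subval-difference vs bs′ bs))))

        spanned-by-hub : Spanned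
        spanned-by-hub = spanned (packing (allFin n))

      spanned-by-kept : Spanned
      spanned-by-kept = spanned-by-hub (hub k n2ᵏ<3ᵏ)

    conclusion : Spanned
    conclusion = spanned-by-kept sample

-- Splitting colour classes into blocks of bounded size

module Chunks {A : Set} (t : ℕ) where
  θ : ℕ
  θ = suc t

  push : A → List (List A) → List (List A)
  push x []       = (x ∷ []) ∷ []
  push x (c ∷ cs) = if length c <ᵇ θ then (x ∷ c) ∷ cs else (x ∷ []) ∷ c ∷ cs

  chunk : List A → List (List A)
  chunk []       = []
  chunk (x ∷ xs) = push x (chunk xs)

  -- Only the head, which is being filled, may be incomplete; this is the source of the single
  -- additional θ in `length-chunk`.
  Sized : List (List A) → ℕ → Set
  Sized []       m = m ≡ 0
  Sized (c ∷ cs) m = length c ≤ θ × All (λ c → length c ≡ θ) cs × length c + length cs * θ ≡ m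

  push-sized : ∀ x cs m → Sized cs m → Sized (push x cs) (suc m)
  push-sized x []       m refl            = s≤s z≤n , [] , refl
  push-sized x (c ∷ cs) m (c≤ , full , e) with length c <ᵇ θ in lt
  ... | true  = <ᵇ⇒< (length c) θ (subst T (sym lt) _) , full , cong suc e
  ... | false = s≤s z≤n , c≡θ ∷ full , cong suc (trans (cong (_+ length cs * θ) (sym c≡θ)) e)
    where
    c≡θ : length c ≡ θ
    c≡θ = ≤-antisym c≤ (≮⇒≥ (λ c<θ → subst T lt (<⇒<ᵇ c<θ)))

  chunk-sized : ∀ xs → Sized (chunk xs) (length xs)
  chunk-sized []       = refl
  chunk-sized (x ∷ xs) = push-sized x (chunk xs) (length xs) (chunk-sized xs)

  chunk-≤ : ∀ xs → All (λ c → length c ≤ θ) (chunk xs)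
  chunk-≤ xs with chunk xs | chunk-sized xs
  ... | []     | _             = []
  ... | c ∷ cs | c≤ , full , _ = c≤ ∷ All.map ≤-reflexive full

  length-chunk : ∀ xs → length (chunk xs) * θ ≤ length xs + θ
  length-chunk xs with chunk xs | chunk-sized xs
  ... | []     | _         = z≤n
  ... | c ∷ cs | _ , _ , e = ≤-trans (≤-reflexive (+-comm θ (length cs * θ)))
                               (+-monoˡ-≤ θ (≤-trans (m≤n+m _ (length c)) (≤-reflexive e)))

  ∈-push-new : ∀ x cs → ∃ λ c → c ∈ₗ push x cs × x ∈ₗ c
  ∈-push-new x []       = _ , here refl , here refl
  ∈-push-new x (c ∷ cs) with length c <ᵇ θ
  ... | true  = _ , here refl , here refl
  ... | false = _ , here refl , here refl

  ∈-push-old : ∀ {y} x cs → (∃ λ c → c ∈ₗ cs × y ∈ₗ c) → ∃ λ c → c ∈ₗ push x cs × y ∈ₗ c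
  ∈-push-old x (c ∷ cs) (d , d∈ , y∈) with length c <ᵇ θ | d∈
  ... | true  | here refl = _ , here refl , there y∈
  ... | true  | there d∈′ = d , there d∈′ , y∈
  ... | false | d∈′       = d , there d∈′ , y∈

  ∈-chunk : ∀ {y} xs → y ∈ₗ xs → ∃ λ c → c ∈ₗ chunk xs × y ∈ₗ c
  ∈-chunk (x ∷ xs) (here refl) = ∈-push-new x (chunk xs)
  ∈-chunk (x ∷ xs) (there y∈)  = ∈-push-old x (chunk xs) (∈-chunk xs y∈)

collect : ∀ {A : Set} {m} → (Fin m → List A) → List A
collect {m = zero}  f = []
collect {m = suc m} f = f zero ++ collect (f ∘ suc)

length-collect : ∀ {A : Set} {m} (f : Fin m → List A) → length (collect f) ≡ sum (length ∘ f)
length-collect {m = zero}  f = refl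
length-collect {m = suc m} f = trans (length-++ (f zero)) (cong (length (f zero) +_) (length-collect (f ∘ suc)))

∈-collect : ∀ {A : Set} {m} (f : Fin m → List A) i {x} → x ∈ₗ f i → x ∈ₗ collect f
∈-collect f zero    x∈ = ∈-++⁺ˡ x∈
∈-collect f (suc i) x∈ = ∈-++⁺ʳ (f zero) (∈-collect (f ∘ suc) i x∈)

collect-All : ∀ {A : Set} {P : A → Set} {m} (f : Fin m → List A) → (∀ i → All P (f i)) → All P (collect f)
collect-All {m = zero}  f h = []
collect-All {m = suc m} f h = Allₚ.++⁺ (h zero) (collect-All (f ∘ suc) (h ∘ suc))

select : ∀ {n} → (Fin n → Bool) → List (Fin n)
select {zero}  P = []
select {suc n} P = (if P zero then zero ∷ [] else []) ++ map suc (select (P ∘ suc))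

length-select : ∀ {n} (P : Fin n → Bool) → length (select P) ≡ count P
length-select {zero}  P = refl
length-select {suc n} P with P zero
... | true  = cong suc (trans (length-map suc (select (P ∘ suc))) (length-select (P ∘ suc)))
... | false = trans (length-map suc (select (P ∘ suc))) (length-select (P ∘ suc))

∈-select : ∀ {n} (P : Fin n → Bool) i → P i ≡ true → i ∈ₗ select P
∈-select {suc n} P zero    p with P zero | p
... | true | _ = here refl
∈-select {suc n} P (suc i) p = ∈-++⁺ʳ (if P zero then zero ∷ [] else []) (∈-map⁺ suc (∈-select (P ∘ suc) i p))

member : ∀ {n} → Fin n → List (Fin n) → Bool
member x []       = false
member x (c ∷ cs) = (x == c) ∨ member x cs

∈⇒member : ∀ {n} {x : Fin n} {cs} → x ∈ₗ cs → member x cs ≡ true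
∈⇒member {x = x} (here refl) = ∨-introˡ (==-refl x)
∈⇒member {x = x} {c ∷ _} (there x∈) = ∨-introʳ {x == c} (∈⇒member x∈)

count-member : ∀ {n} (cs : List (Fin n)) → count (λ x → member x cs) ≤ length cs
count-member {n} []       = ≤-reflexive (sum-replicate-zero n)
count-member     (c ∷ cs) = ≤-trans (count-∨ (_== c) (λ x → member x cs)) (+-mono-≤ (≤-reflexive (sum-χ-== c)) (count-member cs))

-- Popular differences are split into several colours: only when all colour classes are equally small
-- does a uniformly random colour lead to an evenly distributed vertex.
record Refinement {n M : ℕ} (δ : Fin n → Fin n → Fin M) (t : ℕ) : Set where
  field
    N       : ℕ
    col     : Fin n → Fin n → Fin N
    key     : Fin N → Fin M
    key-col : ∀ x y → key (col x y) ≡ δ x y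
    class≤  : ∀ v → sum (λ x → count (λ y → v == col x y)) ≤ suc t
    N≤      : N * suc t ≤ n * n + M * suc t

-- The starting points of the pairs with difference d are cut into chunks, and each chunk is a
-- colour; as x and d determine y, its class is no larger than the chunk. The n² pairs fill complete
-- chunks, and each of the M differences wastes at most one incomplete chunk.
refine : ∀ {n M} (δ : Fin n → Fin n → Fin M) t → (∀ x {y y′} → δ x y ≡ δ x y′ → y ≡ y′) → Refinement δ t
refine {n} {M} δ t δ-inj = record
  { N = length 𝒱 ; col = col ; key = key ; key-col = key-col ; class≤ = class≤ ; N≤ = N≤ }
  where
  open Chunks {Fin n} t
  search : ∀ x d → (∃ λ y → (d == δ x y) ≡ true) ⊎ (∀ y → (d == δ x y) ≡ false)
  search x d = find (λ y → d == δ x y)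
  has : Fin M → Fin n → Bool
  has d x with search x d
  ... | inj₁ _ = true
  ... | inj₂ _ = false
  has-δ : ∀ x y → has (δ x y) x ≡ true
  has-δ x y with search x (δ x y)
  ... | inj₁ _    = refl
  ... | inj₂ none = true≢false (==-refl (δ x y)) (none y)
  χ-has : ∀ d x → χ (has d x) ≤ sum (λ y → χ (d == δ x y))
  χ-has d x with search x d
  ... | inj₁ (y , p) = ≤-trans (≤-reflexive (cong χ (sym p))) (term≤sum (λ y → χ (d == δ x y)) y)
  ... | inj₂ _       = z≤n
  parts : Fin M → List (Fin M × List (Fin n))
  parts d = map (d ,_) (chunk (select (has d)))
  𝒱 : List (Fin M × List (Fin n))
  𝒱 = collect parts
  located : ∀ x y → ∃ λ c → (δ x y , c) ∈ₗ 𝒱 × x ∈ₗ c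
  located x y = let c , c∈ , x∈ = ∈-chunk (select (has (δ x y))) (∈-select (has (δ x y)) x (has-δ x y))
                in c , ∈-collect parts (δ x y) (∈-map⁺ (δ x y ,_) c∈) , x∈
  col : Fin n → Fin n → Fin (length 𝒱)
  col x y = index (proj₁ (proj₂ (located x y)))
  key : Fin (length 𝒱) → Fin M
  key v = proj₁ (List.lookup 𝒱 v)
  block : Fin (length 𝒱) → List (Fin n)
  block v = proj₂ (List.lookup 𝒱 v)
  lookup-col : ∀ x y → (δ x y , proj₁ (located x y)) ≡ List.lookup 𝒱 (col x y)
  lookup-col x y = lookup-index (proj₁ (proj₂ (located x y)))
  key-col : ∀ x y → key (col x y) ≡ δ x y
  key-col x y = sym (cong proj₁ (lookup-col x y))
  block-col : ∀ x y → x ∈ₗ block (col x y)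
  block-col x y = subst (x ∈ₗ_) (cong proj₂ (lookup-col x y)) (proj₂ (proj₂ (located x y)))
  block≤ : ∀ v → length (block v) ≤ suc t
  block≤ v = All.lookup (collect-All {P = λ b → length (proj₂ b) ≤ suc t} parts (λ d → Allₚ.map⁺ (chunk-≤ (select (has d))))) (∈-lookup v)
  class≤ : ∀ v → sum (λ x → count (λ y → v == col x y)) ≤ suc t
  class≤ v = ≤-trans (sum-mono row) (≤-trans (count-member (block v)) (block≤ v))
    where
    row : ∀ x → count (λ y → v == col x y) ≤ χ (member x (block v))
    row x with find (λ y → v == col x y)
    ... | inj₂ none = ≤-trans (≤-reflexive (sum-≗0 (λ y → cong χ (none y)))) z≤n
    ... | inj₁ (y , p) = ≤-trans
          (count-unique (λ y → v == col x y) (λ y y′ p p′ → δ-inj x (trans (sym (key-col x y))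
            (trans (cong key (trans (sym (==⇒≡ v _ p)) (==⇒≡ v _ p′))) (key-col x y′)))))
          (≤-reflexive (cong χ (sym (∈⇒member (subst (λ w → x ∈ₗ block w) (sym (==⇒≡ v (col x y) p)) (block-col x y))))))
  N≤ : length 𝒱 * suc t ≤ n * n + M * suc t
  N≤ = begin
    length 𝒱 * suc t                                       ≡⟨ cong (_* suc t) (length-collect parts) ⟩
    sum (λ d → length (parts d)) * suc t                   ≡⟨ *-distribʳ-sum (suc t) (λ d → length (parts d)) ⟩
    sum (λ d → length (parts d) * suc t)                   ≤⟨ sum-mono part≤ ⟩
    sum (λ d → count (has d) + suc t)                      ≡⟨ ∑-distrib-+ (λ d → count (has d)) (λ _ → suc t) ⟩
    sum (λ d → count (has d)) + sum {M} (λ _ → suc t)      ≡⟨ cong₂ _+_ (∑-comm (λ d x → χ (has d x))) (sum-const M (suc t)) ⟩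
    sum (λ x → sum (λ d → χ (has d x))) + M * suc t        ≤⟨ +-monoˡ-≤ (M * suc t) (sum-mono row≤) ⟩
    sum {n} (λ _ → n) + M * suc t                          ≡⟨ cong (_+ M * suc t) (sum-const n n) ⟩
    n * n + M * suc t                                      ∎
    where
    open ≤-Reasoning
    part≤ : ∀ d → length (parts d) * suc t ≤ count (has d) + suc t
    part≤ d = ≤-trans (≤-reflexive (cong (_* suc t) (length-map (d ,_) (chunk (select (has d))))))
                (≤-trans (length-chunk (select (has d))) (≤-reflexive (cong (_+ suc t) (length-select (has d)))))
    row≤ : ∀ x → sum (λ d → χ (has d x)) ≤ n
    row≤ x = begin
      sum (λ d → χ (has d x))                     ≤⟨ sum-mono (λ d → χ-has d x) ⟩
      sum (λ d → sum (λ y → χ (d == δ x y)))      ≡⟨ ∑-comm (λ d y → χ (d == δ x y)) ⟩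
      sum (λ y → sum (λ d → χ (d == δ x y)))      ≡⟨ sum-cong-≗ (λ y → sum-χ-== (δ x y)) ⟩
      sum {n} (λ _ → 1)                           ≡⟨ trans (sum-const n 1) (*-identityʳ n) ⟩
      n                                           ∎

-- Logarithms and the differences of `A` as colours

n≤2^⌈log₂n⌉ : ∀ n → n ≤ 2 ^ ⌈log₂ n ⌉
n≤2^⌈log₂n⌉ n = go n (<-wellFounded n)
  where
  open ≤-Reasoning
  go : ∀ n → Acc _<_ n → n ≤ 2 ^ ⌈log₂ n ⌉
  go 0 _ = z≤n
  go 1 _ = s≤s z≤n
  go n@(suc (suc m)) (acc rec) = begin
    n                               ≡⟨ ⌊n/2⌋+⌈n/2⌉≡n n ⟨
    ⌊ n /2⌋ + ⌈ n /2⌉               ≤⟨ +-monoˡ-≤ ⌈ n /2⌉ (⌊n/2⌋≤⌈n/2⌉ n) ⟩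
    ⌈ n /2⌉ + ⌈ n /2⌉               ≡⟨ cong (⌈ n /2⌉ +_) (+-identityʳ ⌈ n /2⌉) ⟨
    2 * ⌈ n /2⌉                     ≤⟨ *-monoʳ-≤ 2 (go ⌈ n /2⌉ (rec (⌈n/2⌉<n m))) ⟩
    2 * 2 ^ ⌈log₂ ⌈ n /2⌉ ⌉         ≡⟨ cong (λ z → 2 * 2 ^ z) (⌈log₂⌈n/2⌉⌉≡⌈log₂n⌉∸1 n) ⟩
    2 ^ suc (⌈log₂ n ⌉ ∸ 1)         ≡⟨ cong (2 ^_) (m+[n∸m]≡n {1} (⌈log₂⌉-mono-≤ {2} {n} (s≤s (s≤s z≤n)))) ⟩
    2 ^ ⌈log₂ n ⌉                   ∎

lookup-injective : ∀ {c ℓ} (G : AbelianGroup c ℓ) (A : List (AbelianGroup.Carrier G)) → FinSubset G A →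
                   ∀ {i j} → AbelianGroup._≈_ G (List.lookup A i) (List.lookup A j) → i ≡ j
lookup-injective G (a ∷ A) (a∉ ∷ u) {zero}  {zero}  _ = refl
lookup-injective G (a ∷ A) (a∉ ∷ u) {zero}  {suc j} e = ⊥-elim (All.lookup a∉ (∈-lookup j) e)
lookup-injective G (a ∷ A) (a∉ ∷ u) {suc i} {zero}  e = ⊥-elim (All.lookup a∉ (∈-lookup i) (AbelianGroup.sym G e))
lookup-injective G (a ∷ A) (a∉ ∷ u) {suc i} {suc j} e = cong suc (lookup-injective G A u e)

-- Two epochs gain (3/2)² = 9/4 ≥ 2, and 1 + ⌈log₂ n⌉ doublings exceed n.
epochs : ∀ n → n * 2 ^ (2 * suc ⌈log₂ n ⌉) < 3 ^ (2 * suc ⌈log₂ n ⌉)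
epochs n = begin-strict
  n * 2 ^ (2 * m)     ≡⟨ cong (n *_) (^-*-assoc 2 2 m) ⟨
  n * 4 ^ m           <⟨ *-monoˡ-< (4 ^ m) {{m^n≢0 4 m}} (≤-<-trans (n≤2^⌈log₂n⌉ n) (^-monoʳ-< 2 (s≤s (s≤s z≤n)) (n<1+n ⌈log₂ n ⌉))) ⟩
  2 ^ m * 4 ^ m       ≡⟨ ^-distribʳ-* m 2 4 ⟨
  8 ^ m               ≤⟨ ^-monoˡ-≤ m (n≤1+n 8) ⟩
  9 ^ m               ≡⟨ ^-*-assoc 3 2 m ⟩
  3 ^ (2 * m)         ∎
  where
  open ≤-Reasoning
  m = suc ⌈log₂ n ⌉

module _ {c ℓ : Level} (G : AbelianGroup c ℓ) (A : List (AbelianGroup.Carrier G)) (unique : FinSubset G A)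
         (D : List (AbelianGroup.Carrier G)) (isD : IsDiffSet G A D) where
  open AbelianGroup G renaming (Carrier to X; refl to ≈-refl; sym to ≈-sym; trans to ≈-trans)
  open Spans G

  private
    n M : ℕ
    n = length A
    M = length D
    pt : Fin n → X
    pt = List.lookup A

  difference∈ : ∀ x y → Any ((pt y - pt x) ≈_) D
  difference∈ x y = proj₂ (proj₂ isD) (MemP.∈-lookup setoid A y) (MemP.∈-lookup setoid A x)

  δ : Fin n → Fin n → Fin M
  δ x y = index (difference∈ x y)

  lookup-δ : ∀ x y → pt y - pt x ≈ List.lookup D (δ x y)
  lookup-δ x y = lookup-index (difference∈ x y)

  move : ∀ x y {d} → δ x y ≡ d → pt y ≈ pt x ∙ List.lookup D d
  move x y refl = ≈-trans (≈-sym (identityˡ (pt y))) (≈-trans (∙-congʳ (≈-sym (inverseʳ (pt x)))) (≈-trans (assoc (pt x) (pt x ⁻¹) (pt y))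
                    (∙-congˡ (≈-trans (comm (pt x ⁻¹) (pt y)) (lookup-δ x y)))))

  δ-injʳ : ∀ x {y y′} → δ x y ≡ δ x y′ → y ≡ y′
  δ-injʳ x {y} {y′} eq = lookup-injective G A unique (≈-trans (move x y eq) (≈-sym (move x y′ refl)))

  δ-injˡ : ∀ y {x x′} → δ x y ≡ δ x′ y → x ≡ x′
  δ-injˡ y {x} {x′} eq = lookup-injective G A unique
    (∙-cancelʳ (List.lookup D (δ x′ y)) (pt x) (pt x′) (≈-trans (≈-sym (move x y eq)) (move x′ y refl)))
    where open AGProps G using (∙-cancelʳ)

  n≤M : Fin n → n ≤ M
  n≤M x = injective⇒≤ (δ-injʳ x)

  fromIndices : ∀ S → (∀ x → InSpan G S (pt x)) → ∀ {a} → Any (a ≈_) A → InSpan G S a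
  fromIndices S h a∈A = InSpan-≈ S (lookup-index a∈A) (h (index a∈A))

  trivial : AddDimAtMost G A n
  trivial = A , ≤-refl , fromIndices A (λ x → InSpan-∈ {A} (∈-lookup x))

  -- Up to a factor 2, 1 + l is n/64 and θ = 1 + t is n/k. Then N ≤ 3kn, which gives 384k = 3 · 128k
  -- for the mean number of kept colours and 48k = 16 · 3k for the number of covering centres.
  dimension : (k l t : ℕ) → 0 < k → 64 * suc l ≤ n → n ≤ 128 * suc l →
              M ≤ k * n → k * suc t ≤ n → n ≤ 2 * (k * suc t) →
              ∃ λ J → J ≤ 512 * (2 * suc ⌈log₂ n ⌉) × (∀ β → Digits J β → AddDimAtMost G A (48 * k + 2 * (384 * k) * β + J))
  dimension k l t k>0 64L≤n n≤128L M≤kn kθ≤n n≤2kθ =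
    let J , J≤ , spans = conclusion in J , J≤ , λ β dig → let S , len , h = spans β dig in S , len , fromIndices S h
    where
    open ≤-Reasoning
    open Refinement (refine δ t δ-injʳ)
    θ = suc t
    Nθ≤2n² : N * θ ≤ 2 * (n * n)
    Nθ≤2n² = begin
      N * θ                    ≤⟨ N≤ ⟩
      n * n + M * θ            ≤⟨ +-monoʳ-≤ (n * n) (*-monoˡ-≤ θ M≤kn) ⟩
      n * n + k * n * θ        ≡⟨ r₁ n k θ ⟩
      n * n + k * θ * n        ≤⟨ +-monoʳ-≤ (n * n) (*-monoˡ-≤ n kθ≤n) ⟩
      n * n + n * n            ≡⟨ cong (n * n +_) (+-identityʳ (n * n)) ⟨
      2 * (n * n)              ∎
      where
      r₁ : ∀ n k t → n * n + k * n * t ≡ n * n + k * t * n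
      r₁ = solve-∀
    N≤3kn : N ≤ 3 * (k * n)
    N≤3kn = *-cancelʳ-≤ N (3 * (k * n)) θ (begin
      N * θ                              ≤⟨ N≤ ⟩
      n * n + M * θ                      ≤⟨ +-mono-≤ (*-monoˡ-≤ n n≤2kθ) (*-monoˡ-≤ θ M≤kn) ⟩
      2 * (k * θ) * n + k * n * θ        ≡⟨ r₁ n k θ ⟩
      3 * (k * n) * θ                    ∎)
      where
      r₁ : ∀ n k t → 2 * (k * t) * n + k * n * t ≡ 3 * (k * n) * t
      r₁ = solve-∀
    N≤BL : N ≤ 384 * k * suc l
    N≤BL = begin
      N                          ≤⟨ N≤3kn ⟩
      3 * (k * n)                ≤⟨ *-monoʳ-≤ 3 (*-monoʳ-≤ k n≤128L) ⟩
      3 * (k * (128 * suc l))    ≡⟨ r₁ 3 128 k (suc l) ⟩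
      384 * k * suc l            ∎
      where
      r₁ : ∀ a b k l → a * (k * (b * l)) ≡ a * b * k * l
      r₁ = solve-∀
    16N≤ : 16 * N ≤ 48 * k * n
    16N≤ = begin
      16 * N               ≤⟨ *-monoʳ-≤ 16 N≤3kn ⟩
      16 * (3 * (k * n))   ≡⟨ r₁ 16 3 k n ⟩
      48 * k * n           ∎
      where
      r₁ : ∀ a b k l → a * (b * (k * l)) ≡ a * b * k * l
      r₁ = solve-∀
    col⇒δ : ∀ {x y x′ y′} → col x y ≡ col x′ y′ → δ x y ≡ δ x′ y′
    col⇒δ {x} {y} {x′} {y′} eq = trans (sym (key-col x y)) (trans (cong key eq) (key-col x′ y′))
    open Colouring G n N pt (List.lookup D ∘ key) col (λ x eq → δ-injʳ x (col⇒δ eq))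
           (λ x y → move x y (sym (key-col x y))) θ (s≤s z≤n) Nθ≤2n² class≤ (λ y eq → δ-injˡ y (col⇒δ eq))
    open Conclusion l 64L≤n (384 * k) (≤-trans k>0 (m≤m+n k (383 * k))) N≤BL (48 * k) 16N≤
           (2 * suc ⌈log₂ n ⌉) (epochs n)

-- The coefficient of pℓ in `total-bound`: 2 · 48 + 2 · 768 · 13, which also exceeds the 2048 needed
-- for qL. Opacity keeps the literal from being unfolded.
abstract
  C₀ : ℕ
  C₀ = 20064

  20064≤C₀ : 20064 ≤ C₀
  20064≤C₀ = ≤-refl

total-bound : ∀ k β J L ℓ p q → k * q ≤ 2 * p → 1 ≤ ℓ → β ≤ 13 * ℓ → J ≤ 2048 * L →
              (48 * k + 2 * (384 * k) * β + J) * q ≤ C₀ * (p * ℓ + q * L)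
total-bound k β J L ℓ p q kq≤ 1≤ℓ β≤ J≤ = begin
  (48 * k + 2 * (384 * k) * β + J) * q              ≡⟨ r₁ 48 384 k β J q ⟩
  48 * (k * q) + 2 * 384 * (β * (k * q)) + J * q    ≤⟨ +-mono-≤ (+-mono-≤ (*-monoʳ-≤ 48 kq≤) (*-monoʳ-≤ 768 (*-mono-≤ β≤ kq≤))) (*-monoˡ-≤ q J≤) ⟩
  48 * (2 * p) + 768 * (13 * ℓ * (2 * p)) + 2048 * L * q
                                                    ≡⟨ r₂ 48 768 13 2048 p ℓ L q ⟩
  96 * p + 19968 * (p * ℓ) + 2048 * (q * L)         ≤⟨ +-monoˡ-≤ (2048 * (q * L)) (+-monoˡ-≤ (19968 * (p * ℓ)) (*-monoʳ-≤ 96 (≤-trans (≤-reflexive (sym (*-identityʳ p))) (*-monoʳ-≤ p 1≤ℓ)))) ⟩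
  96 * (p * ℓ) + 19968 * (p * ℓ) + 2048 * (q * L)   ≡⟨ cong (_+ 2048 * (q * L)) (*-distribʳ-+ (p * ℓ) 96 19968) ⟨
  20064 * (p * ℓ) + 2048 * (q * L)                  ≤⟨ +-mono-≤ (*-monoˡ-≤ (p * ℓ) 20064≤C₀) (*-monoˡ-≤ (q * L) (≤-trans (≤ᵇ⇒≤ 2048 20064 _) 20064≤C₀)) ⟩
  C₀ * (p * ℓ) + C₀ * (q * L)                 ≡⟨ *-distribˡ-+ C₀ (p * ℓ) (q * L) ⟨
  C₀ * (p * ℓ + q * L)                           ∎
  where
  open ≤-Reasoning
  r₁ : ∀ a b k β J q → (a * k + 2 * (b * k) * β + J) * q ≡ a * (k * q) + 2 * b * (β * (k * q)) + J * q
  r₁ = solve-∀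
  r₂ : ∀ a b c d p ℓ L q → a * (2 * p) + b * (c * ℓ * (2 * p)) + d * L * q ≡ a * 2 * p + b * c * 2 * (p * ℓ) + d * (q * L)
  r₂ = solve-∀

-- Choice of parameters and the two bounds

module Cases {c ℓ : Level} (G : AbelianGroup c ℓ) (A : List (AbelianGroup.Carrier G)) (unique : FinSubset G A)
             (3≤n : 3 ≤ length A) (p q : ℕ)
             (D : List (AbelianGroup.Carrier G)) (isD : IsDiffSet G A D) (small : length D * q ≤ p * length A) where
  open Spans G

  private
    n M L k : ℕ
    n = length A
    M = length D
    L = ⌈log₂ n ⌉

    instance
      n≢0 : NonZero n
      n≢0 = >-nonZero (≤-trans (s≤s z≤n) 3≤n)

    -- An integer between M/n and 2M/n, as M ≥ n; so it exceeds p/q by at most a factor 2.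
    k = suc (M / n)

  n≤M′ : n ≤ M
  n≤M′ = go 3≤n (n≤M G A unique D isD)
    where
    go : ∀ {m M} → 3 ≤ m → (Fin m → m ≤ M) → m ≤ M
    go (s≤s _) h = h zero

  M≤kn : M ≤ k * n
  M≤kn = begin
    M                    ≡⟨ m≡m%n+[m/n]*n M n ⟩
    M % n + M / n * n    ≤⟨ +-monoˡ-≤ (M / n * n) (<⇒≤ (m%n<n M n)) ⟩
    k * n                ∎
    where open ≤-Reasoning

  kq≤2p : k * q ≤ 2 * p
  kq≤2p = *-cancelʳ-≤ (k * q) (2 * p) n (begin
    k * q * n              ≡⟨ r₁ k q n ⟩
    k * n * q              ≤⟨ *-monoˡ-≤ q (+-mono-≤ n≤M′ (m/n*n≤m M n)) ⟩
    (M + M) * q            ≡⟨ r₂ M q ⟩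
    2 * (M * q)            ≤⟨ *-monoʳ-≤ 2 small ⟩
    2 * (p * n)            ≡⟨ *-assoc 2 p n ⟨
    2 * p * n              ∎)
    where
    open ≤-Reasoning
    r₁ : ∀ k q n → k * q * n ≡ k * n * q
    r₁ = solve-∀
    r₂ : ∀ M q → (M + M) * q ≡ 2 * (M * q)
    r₂ = solve-∀

  2≤L : 2 ≤ L
  2≤L = ⌈log₂⌉-mono-≤ {3} {n} 3≤n

  Bound : ℕ → Set (c ⊔ ℓ)
  Bound m′ = ∃ λ d → AddDimAtMost G A d × d * q ≤ C₀ * (p * m′ + q * L)

  -- The number of digits is ⌈log₂ log₂ n⌉ + O(1) in general and ⌈log₂ r⌉ in exponent r.
  conclude : ∀ m′ → 1 ≤ m′ → (∀ J → J ≤ 2048 * L → ∃ λ β → β ≤ 13 * m′ × Digits J β) → Bound m′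
  conclude m′ 1≤m′ digits = cases (64 ≤? n) (k ≤? n)
    where
    open ≤-Reasoning
    viaTrivial : n * q ≤ C₀ * (p * m′ + q * L) → Bound m′
    viaTrivial h = n , trivial G A unique D isD , h
    cases : Dec (64 ≤ n) → Dec (k ≤ n) → Bound m′
    cases (no n≱64) _ = viaTrivial (begin
      n * q                              ≤⟨ *-monoˡ-≤ q (<⇒≤ (≰⇒> n≱64)) ⟩
      64 * q                             ≤⟨ *-mono-≤ (≤-trans (≤ᵇ⇒≤ 64 20064 _) 20064≤C₀) (≤-trans (≤-reflexive (sym (*-identityʳ q))) (*-monoʳ-≤ q (≤-trans (n≤1+n 1) 2≤L))) ⟩
      C₀ * (q * L)                    ≤⟨ *-monoʳ-≤ C₀ (m≤n+m (q * L) (p * m′)) ⟩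
      C₀ * (p * m′ + q * L)           ∎)
    -- Here θ = ⌊n/k⌋ would vanish, but `A` itself is short enough as a spanning sequence: n < k ≤
    -- 2p/q.
    cases (yes _) (no k≰n) = viaTrivial (begin
      n * q                              ≤⟨ *-monoˡ-≤ q (<⇒≤ (≰⇒> k≰n)) ⟩
      k * q                              ≤⟨ kq≤2p ⟩
      2 * p                              ≤⟨ *-mono-≤ (≤-trans (≤ᵇ⇒≤ 2 20064 _) 20064≤C₀) (≤-trans (≤-reflexive (sym (*-identityʳ p))) (*-monoʳ-≤ p 1≤m′)) ⟩
      C₀ * (p * m′)                   ≤⟨ *-monoʳ-≤ C₀ (m≤m+n (p * m′) (q * L)) ⟩
      C₀ * (p * m′ + q * L)           ∎)
    cases (yes 64≤n) (yes k≤n) = main (n / 64) refl (n / k) refl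
      where
      quotient-pos : ∀ m d .{{_ : NonZero d}} → d ≤ m → ¬ (m / d ≡ 0)
      quotient-pos m d d≤m eq = <-irrefl refl (<-≤-trans (<-≤-trans (m%n<n m d) d≤m)
        (≤-reflexive (trans (m≡m%n+[m/n]*n m d) (trans (cong (λ z → m % d + z * d) eq) (+-identityʳ (m % d))))))
      upper : ∀ m d .{{_ : NonZero d}} s → m / d ≡ suc s → m ≤ 2 * (suc s * d)
      upper m d s eq = begin
        m                        ≡⟨ m≡m%n+[m/n]*n m d ⟩
        m % d + m / d * d        ≡⟨ cong (λ z → m % d + z * d) eq ⟩
        m % d + suc s * d        ≤⟨ +-monoˡ-≤ (suc s * d) (≤-trans (<⇒≤ (m%n<n m d)) (m≤m+n d (s * d))) ⟩
        suc s * d + suc s * d    ≡⟨ cong (suc s * d +_) (+-identityʳ (suc s * d)) ⟨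
        2 * (suc s * d)          ∎
      lower : ∀ m d .{{_ : NonZero d}} s → m / d ≡ suc s → d * suc s ≤ m
      lower m d s eq = ≤-trans (≤-reflexive (trans (*-comm d (suc s)) (cong (_* d) (sym eq)))) (m/n*n≤m m d)
      main : ∀ u → n / 64 ≡ u → ∀ v → n / k ≡ v → Bound m′
      main zero    eq _       _   = ⊥-elim (quotient-pos n 64 64≤n eq)
      main (suc _) _  zero    eq′ = ⊥-elim (quotient-pos n k k≤n eq′)
      main (suc l) eq (suc t) eq′ = finish (dimension G A unique D isD k l t (s≤s z≤n) (lower n 64 l eq)
          (≤-trans (upper n 64 l eq) (≤-reflexive (r 2 64 (suc l)))) M≤kn (lower n k t eq′)
          (≤-trans (upper n k t eq′) (≤-reflexive (cong (2 *_) (*-comm (suc t) k)))))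
        where
        r : ∀ a b l → a * (l * b) ≡ a * b * l
        r = solve-∀
        finish : (∃ λ J → J ≤ 512 * (2 * suc L) × (∀ β → Digits J β → AddDimAtMost G A (48 * k + 2 * (384 * k) * β + J))) → Bound m′
        finish (J , J≤ , dims) = let β , β≤ , dig = digits J J≤′ in
          48 * k + 2 * (384 * k) * β + J , dims β dig , total-bound k β J L m′ p q kq≤2p 1≤m′ β≤ J≤′
          where
          J≤′ : J ≤ 2048 * L
          J≤′ = begin
            J                      ≤⟨ J≤ ⟩
            512 * (2 * suc L)      ≡⟨ *-assoc 512 2 (suc L) ⟨
            1024 * suc L           ≤⟨ *-monoʳ-≤ 1024 (+-monoˡ-≤ L (≤-trans (n≤1+n 1) 2≤L)) ⟩
            1024 * (L + L)         ≡⟨ cong (λ z → 1024 * (L + z)) (+-identityʳ L) ⟨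
            1024 * (2 * L)         ≡⟨ *-assoc 1024 2 L ⟨
            2048 * L               ∎

  general : Bound ⌈log₂ L ⌉
  -- Since 2048 = 2^11, eleven further bits would hold 2048 L up to equality; the twelfth makes the
  -- inequality strict.
  general = conclude ⌈log₂ L ⌉ 1≤ℓℓ (λ J J≤ → 12 + ⌈log₂ L ⌉ , β≤ , digits-bounded J _ (J< J J≤))
    where
    open ≤-Reasoning
    1≤ℓℓ : 1 ≤ ⌈log₂ L ⌉
    1≤ℓℓ = ⌈log₂⌉-mono-≤ {2} {L} 2≤L
    β≤ : 12 + ⌈log₂ L ⌉ ≤ 13 * ⌈log₂ L ⌉
    β≤ = begin
      12 + ⌈log₂ L ⌉                 ≤⟨ +-monoˡ-≤ ⌈log₂ L ⌉ (*-monoʳ-≤ 12 1≤ℓℓ) ⟩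
      12 * ⌈log₂ L ⌉ + ⌈log₂ L ⌉     ≡⟨ +-comm (12 * ⌈log₂ L ⌉) ⌈log₂ L ⌉ ⟩
      13 * ⌈log₂ L ⌉                 ∎
    J< : ∀ J → J ≤ 2048 * L → J < 2 ^ (12 + ⌈log₂ L ⌉)
    J< J J≤ = begin-strict
      J                              ≤⟨ J≤ ⟩
      2048 * L                       ≤⟨ *-monoʳ-≤ 2048 (n≤2^⌈log₂n⌉ L) ⟩
      2048 * 2 ^ ⌈log₂ L ⌉           <⟨ *-monoˡ-< (2 ^ ⌈log₂ L ⌉) {{m^n≢0 2 ⌈log₂ L ⌉}} (<ᵇ⇒< 2048 4096 _) ⟩
      2 ^ 12 * 2 ^ ⌈log₂ L ⌉         ≡⟨ ^-distribˡ-+-* 2 12 ⌈log₂ L ⌉ ⟨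
      2 ^ (12 + ⌈log₂ L ⌉)           ∎

  torsion : ∀ r → 2 ≤ r → HasExponent G r → Bound ⌈log₂ r ⌉
  torsion r 2≤r (_ , rx≈ε , _) = conclude ⌈log₂ r ⌉ (⌈log₂⌉-mono-≤ {2} {r} 2≤r)
    (λ J _ → ⌈log₂ r ⌉ , m≤m+n ⌈log₂ r ⌉ (12 * ⌈log₂ r ⌉) ,
       digits-torsion r {{>-nonZero (≤-trans (s≤s z≤n) 2≤r)}} J ⌈log₂ r ⌉ rx≈ε (n≤2^⌈log₂n⌉ r))

theorem1p8 : Σℕω λ C →
    ∀ {c ℓ : Level} (G : AbelianGroup c ℓ) (A : List (AbelianGroup.Carrier G)) →
    FinSubset G A → 3 ≤ length A →
    (p q : ℕ) → 1 ≤ q →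
    (D : List (AbelianGroup.Carrier G)) → IsDiffSet G A D →
    length D * q ≤ p * length A →
    (∃ λ d → AddDimAtMost G A d ×
    d * q ≤ C * (p * ⌈log₂ ⌈log₂ length A ⌉ ⌉ + q * ⌈log₂ length A ⌉))
    × (∀ r → 2 ≤ r → HasExponent G r →
    ∃ λ d → AddDimAtMost G A d ×
    d * q ≤ C * (p * ⌈log₂ r ⌉ + q * ⌈log₂ length A ⌉))
theorem1p8 = C₀ , λ G A u 3≤n p q _ D isD small →
  Cases.general G A u 3≤n p q D isD small , Cases.torsion G A u 3≤n p q D isD small
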